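{- Let ${\sf FinDiam}_{\sf conn}$ be the following formula about a countable graph $G=(V,E)$: $$\exists r\ \forall\gamma\in{\rm Path}_G\ \exists\delta\in{\rm Path}_G\ \big[\{\gamma_{\rm start},\gamma_{\rm end}\}=\{\delta_{\rm start},\delta_{\rm end}\}\ \wedge\ |\delta|\le r\big].$$ Then ${\sf FinDiam}_{\sf conn}$ is $\forall^\infty\forall\exists$-dicomplete.
   Context: Quantifiers range over $\omega$. $\exists^\infty n\,\varphi(n)$ means $\forall m\exists n\ge m\,\varphi(n)$ and $\forall^\infty n\,\varphi(n)$ means $\exists m\forall n\ge m\,\varphi(n)$. A quantifier-pattern is a finite string $\bar{\mathsf Q}=\mathsf Q_0\dots\mathsf Q_\ell$ over $\{\exists,\forall,\exists^\infty,\forall^\infty\}$. A $\bar{\mathsf Q}$-formula is $\varphi(\bar x)\equiv\mathsf Q_0n_0\dots\mathsf Q_\ell n_\ell\,\theta(n_0,\dots,n_\ell,\bar x)$ with $\theta$ a bounded formula. The instance $\bar x$ is a tuple of natural numbers and/or total computable functions (computable elements of $\omega^\omega$). Spaces such as $\omega\times\omega^\omega$, $(\omega^\omega)^\omega$, $\omega^{\omega\times\omega}$ are identified with $\omega^\omega$ by computable pairing. Witnesses: for $\alpha\in\omega^\omega$, $\alpha\Vdash\varphi(\bar x)$ ("$\alpha$ is a witness for $\varphi(\bar x)$") is defined by: $\alpha\Vdash\theta(\bar x)$ iff $\alpha=\bar x$ and $\theta(\bar x)$, for bounded $\theta$; $\langle t,\alpha\rangle\Vdash\exists n\varphi(n,\bar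 x)$ iff $\alpha\Vdash\varphi(t,\bar x)$; $\alpha\Vdash\forall n\varphi(n,\bar x)$ iff $\alpha(n)\Vdash\varphi(n,\bar x)$ for all $n$; $\langle t,\alpha\rangle\Vdash\forall^\infty n\varphi(n,\bar x)$ iff $\alpha(n)\Vdash\varphi(n,\bar x)$ for all $n\ge t$; $\alpha\Vdash\exists^\infty n\varphi(n,\bar x)$ iff for all $n$, writing $\alpha(n)=\langle k,\beta\rangle$, $k\ge n$ and $\beta\Vdash\varphi(k,\bar x)$. Reducibility: $\varphi\le_{\sf m}\psi$ if there are computable functions $\eta,r_-,r_+$ (type-two computable functionals, possibly partial but defined wherever required) such that for every instance $\bar x$: $\varphi(\bar x)$ is true iff $\psi(\eta(\bar x))$ is true; $\alpha\Vdash\varphi(\bar x)$ implies $r_-(\alpha,\bar x)\Vdash\psi(\eta(\bar x))$; $\alpha\Vdash\psi(\eta(\bar x))$ implies $r_+(\alpha,\bar x)\Vdash\varphi(\bar x)$ ($\alpha\in\omega^\omega$ arbitrary). The dual $\varphi^{\sf d}$ of $\mathsf Q_0n_0\dots\mathsf Q_\ell n_\ell\,\theta$ is $\mathsf Q_0^{\sf d}n_0\dots\mathsf Q_\ell^{\sf d}n_\ell\,\neg\theta$, where $\exists^{\sf d}=\forall$, $\forall^{\sf d}=\exists$, $(\exists^\infty)^{\sf d}=\forall^\infty$, $(\forall^\infty)^{\sf d}=\exists^\infty$. $\varphi\le_{\sf dm}\psi$ if $\varphi\le_{\sf m}\psi$ and $\varphi^{\sf d}\le_{\sf m}\psi^{\sf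 d}$ via a common $\eta$ (the $r_\pm$ may differ). $\varphi$ is strictly $\bar{\mathsf Q}$-dicomplete if it is a $\bar{\mathsf Q}$-formula and $\psi\le_{\sf dm}\varphi$ for every $\bar{\mathsf Q}$-formula $\psi$; it is $\bar{\mathsf Q}$-dicomplete if it is $\equiv_{\sf dm}$-equivalent to a strictly $\bar{\mathsf Q}$-dicomplete formula (one such is $\mathsf Q_0n_0\dots\mathsf Q_\ell n_\ell.\ x(n_0,\dots,n_\ell)=0$). Structures: a countable binary relation $(X,R)$, $X\subseteq\omega$, $R\subseteq X^2$, is coded by the pair of characteristic functions of $X$ and $R$, and is identified with its code. Graphs are undirected. Instances are (computable) codes of graphs; reductions from the problem need only work on such codes and reductions to it must output such codes. ${\rm Path}_G$ is the set of (codes of) finite paths of $G$; for a path $\gamma$, $\gamma_{\rm start},\gamma_{\rm end}$ are its start and end points and $|\gamma|$ its length (number of edges). Restricted quantifiers mean $\forall\gamma(\gamma\in{\rm Path}_G\to\cdots)$, $\exists\delta(\delta\in{\rm Path}_G\wedge\cdots)$, with these decidable conditions moved into the innermost bounded part. -}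

module Defs where

open import Data.Nat.Base using (ℕ; zero; suc; _+_; _*_; _∸_; _≤_; _<_)
open import Data.Fin.Base using (Fin; zero; suc)
open import Data.Fin.Patterns using (0F; 1F; 2F)
open import Data.List.Base using (List; []; _∷_; map; length)
open import Data.Product.Base using (Σ-syntax; ∃-syntax; _×_; _,_; proj₁; proj₂)
open import Data.Sum.Base using (_⊎_)
open import Data.Vec.Base as Vec using (Vec; []; _∷_)
open import Data.Vec.Relation.Unary.All using (All)
open import Function.Base using (_∘_)
open import Function.Bundles using (_⇔_)
open import Relation.Binary.PropositionalEquality using (_≡_; _≗_)
open import Relation.Nullary.Negation using (¬_)

Baire : Set
Baire = ℕ → ℕ

triangle : ℕ → ℕ
triangle zero    = zero
triangle (suc n) = suc n + triangle n

-- Cantor's bijection; it enumerates (0,0), (1,0), (0,1), (2,0), (1,1), …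
pair : ℕ → ℕ → ℕ
pair m n = triangle (m + n) + n

nextPair : ℕ × ℕ → ℕ × ℕ
nextPair (zero  , n) = suc n , zero
nextPair (suc m , n) = m , suc n

unpair : ℕ → ℕ × ℕ
unpair zero    = zero , zero
unpair (suc c) = nextPair (unpair c)

decodeWithin : ℕ → ℕ → List ℕ
decodeWithin zero       _       = []
decodeWithin (suc fuel) zero    = []
decodeWithin (suc fuel) (suc c) =
  proj₁ (unpair c) ∷ decodeWithin fuel (proj₂ (unpair c))

-- The bijection ℕ ≅ List ℕ with 0 ↦ [] and 1 + pair m c ↦ m ∷ decode c.
-- Both components of unpair c are at most c, so the fuel c never runs out.
decode : ℕ → List ℕ
decode c = decodeWithin c c

entry : List ℕ → ℕ → ℕ
entry []       _       = zero
entry (m ∷ ms) zero    = m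
entry (m ∷ ms) (suc i) = entry ms i

-- Identifications with Baire.  A number t and a sequence α are coded by the
-- sequence t , α 0 , α 1 , …; two sequences are coded by interleaving; and a
-- sequence of sequences (αₙ)ₙ is coded by α with α (pair n k) = αₙ k.
infixr 5 _∷ᵇ_ _⊕_

_∷ᵇ_ : ℕ → Baire → Baire
(t ∷ᵇ α) zero    = t
(t ∷ᵇ α) (suc n) = α n

head : Baire → ℕ
head α = α zero

tail : Baire → Baire
tail α = α ∘ suc

_⊕_ : Baire → Baire → Baire
(α ⊕ β) zero          = α zero
(α ⊕ β) (suc zero)    = β zero
(α ⊕ β) (suc (suc n)) = (tail α ⊕ tail β) n

section : Baire → ℕ → Baire
section α n k = α (pair n k)

-- Tuples of `a` numbers and `b` functions.
Tuple : ℕ → ℕ → Set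
Tuple a b = Vec ℕ a × Vec Baire b

codeFunctions : ∀ {b} → Vec Baire b → Baire
codeFunctions []                = λ _ → zero
codeFunctions (f ∷ [])          = f
codeFunctions (f ∷ fs@(_ ∷ _))  = f ⊕ codeFunctions fs

code : ∀ {a b} → Tuple a b → Baire
code ([]     , fs) = codeFunctions fs
code (n ∷ ns , fs) = n ∷ᵇ code (ns , fs)

-- Programs for the μ-recursive functions relative to k oracles.
data Rec (k : ℕ) : ℕ → Set where
  zeroᴿ   : Rec k 0
  sucᴿ    : Rec k 1
  projᴿ   : ∀ {n} → Fin n → Rec k n
  oracleᴿ : Fin k → Rec k 1
  compᴿ   : ∀ {m n} → Rec k m → Vec (Rec k n) m → Rec k n
  primᴿ   : ∀ {n} → Rec k n → Rec k (suc (suc n)) → Rec k (suc n)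
  μᴿ      : ∀ {n} → Rec k (suc n) → Rec k n

-- Eval αs e xs y: with oracles αs, the program e on input xs halts with value y.
data Eval {k : ℕ} (αs : Vec Baire k) : ∀ {n} → Rec k n → Vec ℕ n → ℕ → Set where
  evalZero   : Eval αs zeroᴿ [] zero
  evalSuc    : ∀ {x} → Eval αs sucᴿ (x ∷ []) (suc x)
  evalProj   : ∀ {n} {xs : Vec ℕ n} (i : Fin n) → Eval αs (projᴿ i) xs (Vec.lookup xs i)
  evalOracle : ∀ {x} (i : Fin k) → Eval αs (oracleᴿ i) (x ∷ []) (Vec.lookup αs i x)
  evalComp   : ∀ {m n} {f : Rec k m} {gs : Vec (Rec k n) m} {xs : Vec ℕ n}
               (ys : Vec ℕ m) {z : ℕ} →
               (∀ i → Eval αs (Vec.lookup gs i) xs (Vec.lookup ys i)) →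
               Eval αs f ys z → Eval αs (compᴿ f gs) xs z
  evalPrim0  : ∀ {n} {g : Rec k n} {h : Rec k (suc (suc n))} {xs : Vec ℕ n} {z : ℕ} →
               Eval αs g xs z → Eval αs (primᴿ g h) (zero ∷ xs) z
  evalPrimS  : ∀ {n} {g : Rec k n} {h : Rec k (suc (suc n))} {xs : Vec ℕ n} {m y z : ℕ} →
               Eval αs (primᴿ g h) (m ∷ xs) y → Eval αs h (m ∷ y ∷ xs) z →
               Eval αs (primᴿ g h) (suc m ∷ xs) z
  evalμ      : ∀ {n} {f : Rec k (suc n)} {xs : Vec ℕ n} {m : ℕ} →
               (∀ i → i < m → ∃[ y ] Eval αs f (i ∷ xs) (suc y)) →
               Eval αs f (m ∷ xs) zero → Eval αs (μᴿ f) xs m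

-- A program with k oracles and one input is a partial functional from Baireᵏ to
-- Baire; it is defined at αs, with value β, when it halts with value β n on every n.
Computes : ∀ {k} → Rec k 1 → Vec Baire k → Baire → Set
Computes e αs β = ∀ n → Eval αs e (n ∷ []) (β n)

Computable : Baire → Set
Computable f = ∃[ e ] Computes {0} e [] f

-- Terms and bounded formulas have `a` number variables (de Bruijn indices) and `b`
-- function variables.  Besides 0, S, +, · the language has symbols for truncated subtraction, pairing,
-- and the length and the entries of the finite sequence coded by a number; functions
-- of several arguments are applied to paired arguments.

infixl 7 _*̇_
infixl 6 _+̇_ _∸̇_
infixl 8 _!_
infix  9 _·_
infix  5 _≐_ _≤̇_
infixr 4 _∧̇_
infixr 3 _∨̇_
infixr 2 _⇒̇_

data Term (b a : ℕ) : Set where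
  var           : Fin a → Term b a
  0̇             : Term b a
  Ṡ             : Term b a → Term b a
  _+̇_ _*̇_ _∸̇_   : Term b a → Term b a → Term b a
  ⟪_,_⟫         : Term b a → Term b a → Term b a
  len           : Term b a → Term b a
  _!_           : Term b a → Term b a → Term b a
  _·_           : Fin b → Term b a → Term b a

data Bounded (b a : ℕ) : Set where
  _≐_ _≤̇_       : Term b a → Term b a → Bounded b a
  ¬̇_            : Bounded b a → Bounded b a
  _∧̇_ _∨̇_ _⇒̇_   : Bounded b a → Bounded b a → Bounded b a
  ∀<_∙_ ∃<_∙_   : Term b a → Bounded b (suc a) → Bounded b a

⟦_⟧ₜ : ∀ {b a} → Term b a → Tuple a b → ℕ
⟦ var i ⟧ₜ     (ns , fs) = Vec.lookup ns i
⟦ 0̇ ⟧ₜ         x = zero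
⟦ Ṡ t ⟧ₜ       x = suc (⟦ t ⟧ₜ x)
⟦ t +̇ u ⟧ₜ     x = ⟦ t ⟧ₜ x + ⟦ u ⟧ₜ x
⟦ t *̇ u ⟧ₜ     x = ⟦ t ⟧ₜ x * ⟦ u ⟧ₜ x
⟦ t ∸̇ u ⟧ₜ     x = ⟦ t ⟧ₜ x ∸ ⟦ u ⟧ₜ x
⟦ ⟪ t , u ⟫ ⟧ₜ x = pair (⟦ t ⟧ₜ x) (⟦ u ⟧ₜ x)
⟦ len t ⟧ₜ     x = length (decode (⟦ t ⟧ₜ x))
⟦ t ! u ⟧ₜ     x = entry (decode (⟦ t ⟧ₜ x)) (⟦ u ⟧ₜ x)
⟦ f · t ⟧ₜ     x@(ns , fs) = Vec.lookup fs f (⟦ t ⟧ₜ x)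

infixr 5 _◂_

_◂_ : ∀ {a b} → ℕ → Tuple a b → Tuple (suc a) b
n ◂ (ns , fs) = n ∷ ns , fs

⟦_⟧ : ∀ {b a} → Bounded b a → Tuple a b → Set
⟦ t ≐ u ⟧    x = ⟦ t ⟧ₜ x ≡ ⟦ u ⟧ₜ x
⟦ t ≤̇ u ⟧    x = ⟦ t ⟧ₜ x ≤ ⟦ u ⟧ₜ x
⟦ ¬̇ θ ⟧      x = ¬ ⟦ θ ⟧ x
⟦ θ ∧̇ ρ ⟧    x = ⟦ θ ⟧ x × ⟦ ρ ⟧ x
⟦ θ ∨̇ ρ ⟧    x = ⟦ θ ⟧ x ⊎ ⟦ ρ ⟧ x
⟦ θ ⇒̇ ρ ⟧    x = ⟦ θ ⟧ x → ⟦ ρ ⟧ x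
⟦ ∀< t ∙ θ ⟧ x = ∀ i → i < ⟦ t ⟧ₜ x → ⟦ θ ⟧ (i ◂ x)
⟦ ∃< t ∙ θ ⟧ x = ∃[ i ] i < ⟦ t ⟧ₜ x × ⟦ θ ⟧ (i ◂ x)

data Quantifier : Set where
  `∃ `∀ `∃∞ `∀∞ : Quantifier

Pattern : Set
Pattern = List Quantifier

-- Each quantifier binds the number variable 0 of its scope.
data Formula (b : ℕ) : Pattern → ℕ → Set where
  matrix : ∀ {a} → Bounded b a → Formula b [] a
  quant  : ∀ {Q̄ a} (Q : Quantifier) → Formula b Q̄ (suc a) → Formula b (Q ∷ Q̄) a

True : ∀ {b Q̄ a} → Formula b Q̄ a → Tuple a b → Set
True (matrix θ)    x = ⟦ θ ⟧ x
True (quant `∃ φ)  x = ∃[ n ] True φ (n ◂ x)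
True (quant `∀ φ)  x = ∀ n → True φ (n ◂ x)
True (quant `∃∞ φ) x = ∀ m → ∃[ n ] m ≤ n × True φ (n ◂ x)
True (quant `∀∞ φ) x = ∃[ m ] (∀ n → m ≤ n → True φ (n ◂ x))

-- Witness φ α x: α is a witness for φ(x).  Quantified values are prepended to the
-- instance, so at the matrix α must code (n_ℓ, …, n₀, x).
Witness : ∀ {b Q̄ a} → Formula b Q̄ a → Baire → Tuple a b → Set
Witness (matrix θ)    α x = α ≗ code x × ⟦ θ ⟧ x
Witness (quant `∃ φ)  α x = Witness φ (tail α) (head α ◂ x)
Witness (quant `∀ φ)  α x = ∀ n → Witness φ (section α n) (n ◂ x)
Witness (quant `∃∞ φ) α x =
  ∀ n → n ≤ head (section α n) × Witness φ (tail (section α n)) (head (section α n) ◂ x)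
Witness (quant `∀∞ φ) α x = ∀ n → head α ≤ n → Witness φ (section (tail α) n) (n ◂ x)

dualQ : Quantifier → Quantifier
dualQ `∃  = `∀
dualQ `∀  = `∃
dualQ `∃∞ = `∀∞
dualQ `∀∞ = `∃∞

dual : ∀ {b Q̄ a} → Formula b Q̄ a → Formula b (map dualQ Q̄) a
dual (matrix θ)  = matrix (¬̇ θ)
dual (quant Q φ) = quant (dualQ Q) (dual φ)

-- A formula together with the condition singling out the tuples of numbers and
-- computable functions that count as its instances.
record Problem : Set₁ where
  field
    {prefix}            : Pattern
    {numbers functions} : ℕ
    formula             : Formula functions prefix numbers
    Admissible          : Tuple numbers functions → Set

  Instance : Tuple numbers functions → Set
  Instance x@(ns , fs) = All Computable fs × Admissible x

open Problem

_ᵈ : Problem → Problem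
P ᵈ = record { formula = dual (formula P) ; Admissible = Admissible P }

ReducesVia : Rec 1 1 → Problem → Problem → Set
ReducesVia η P Q =
  Σ[ r₋ ∈ Rec 2 1 ] Σ[ r₊ ∈ Rec 2 1 ]
  (∀ x → Instance P x →
   ∃[ y ] Instance Q y
     × Computes η (code x ∷ []) (code y)
     × (True (formula P) x ⇔ True (formula Q) y)
     × (∀ α → Witness (formula P) α x →
        ∃[ β ] Computes r₋ (α ∷ code x ∷ []) β × Witness (formula Q) β y)
     × (∀ α → Witness (formula Q) α y →
        ∃[ β ] Computes r₊ (α ∷ code x ∷ []) β × Witness (formula P) β x))

infix 4 _≤m_ _≤dm_ _≡dm_

_≤m_ : Problem → Problem → Set
P ≤m Q = ∃[ η ] ReducesVia η P Q

_≤dm_ : Problem → Problem → Set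
P ≤dm Q = ∃[ η ] ReducesVia η P Q × ReducesVia η (P ᵈ) (Q ᵈ)

_≡dm_ : Problem → Problem → Set
P ≡dm Q = P ≤dm Q × Q ≤dm P

data Unrestricted {a b : ℕ} (x : Tuple a b) : Set where
  unrestricted : Unrestricted x

⌈_⌉ : ∀ {b Q̄ a} → Formula b Q̄ a → Problem
⌈ φ ⌉ = record { formula = φ ; Admissible = Unrestricted }

StrictlyDicomplete : ∀ {b a} (Q̄ : Pattern) → Formula b Q̄ a → Set
StrictlyDicomplete Q̄ φ = ∀ {b a} (ψ : Formula b Q̄ a) → ⌈ ψ ⌉ ≤dm ⌈ φ ⌉

Dicomplete : Pattern → Problem → Set
Dicomplete Q̄ P =
  ∃[ b ] ∃[ a ] Σ[ φ ∈ Formula b Q̄ a ] StrictlyDicomplete Q̄ φ × P ≡dm ⌈ φ ⌉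

-- (χV , χE) codes V ⊆ ℕ and a symmetric E ⊆ V²; loops are not excluded.
record IsGraph (χV χE : Baire) : Set where
  field
    V-characteristic : ∀ u → χV u ≤ 1
    E-characteristic : ∀ c → χE c ≤ 1
    E⊆V²             : ∀ u v → χE (pair u v) ≡ 1 → χV u ≡ 1 × χV v ≡ 1
    E-symmetric      : ∀ u v → χE (pair u v) ≡ 1 → χE (pair v u) ≡ 1

GraphCode : Tuple 0 2 → Set
GraphCode ([] , χV ∷ χE ∷ []) = IsGraph χV χE

1̇ : ∀ {b a} → Term b a
1̇ = Ṡ 0̇

V[_] : ∀ {a} → Term 2 a → Bounded 2 a
V[ u ] = 0F · u ≐ 1̇

E[_,_] : ∀ {a} → Term 2 a → Term 2 a → Bounded 2 a
E[ u , v ] = 1F · ⟪ u , v ⟫ ≐ 1̇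

-- A finite path is coded by the nonempty sequence of its vertices, which are distinct
-- and consecutively adjacent.
isPath : ∀ {a} → Fin a → Bounded 2 a
isPath γ =
    1̇ ≤̇ len (var γ)
  ∧̇ (∀< len (var γ) ∙ V[ γ₁ ! var 0F ])
  ∧̇ (∀< len (var γ) ∸̇ 1̇ ∙ E[ γ₁ ! var 0F , γ₁ ! Ṡ (var 0F) ])
  ∧̇ (∀< len (var γ) ∙ ∀< var 0F ∙ ¬̇ (γ₂ ! var 0F ≐ γ₂ ! var 1F))
  where
  γ₁ = var (suc γ)
  γ₂ = var (suc (suc γ))

length[_] start[_] end[_] : ∀ {b a} → Fin a → Term b a
length[ γ ] = len (var γ) ∸̇ 1̇
start[ γ ]  = var γ ! 0̇
end[ γ ]    = var γ ! length[ γ ]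

sameEnds : ∀ {b a} → Fin a → Fin a → Bounded b a
sameEnds γ δ = (start[ γ ] ≐ start[ δ ] ∧̇ end[ γ ] ≐ end[ δ ])
             ∨̇ (start[ γ ] ≐ end[ δ ] ∧̇ end[ γ ] ≐ start[ δ ])

FinDiamFormula : Formula 2 (`∃ ∷ `∀ ∷ `∃ ∷ []) 0
FinDiamFormula =
  quant `∃ (quant `∀ (quant `∃ (matrix
    (isPath γ ⇒̇ (isPath δ ∧̇ sameEnds γ δ ∧̇ length[ δ ] ≤̇ var r)))))
  where
  r γ δ : Fin 3
  r = 2F
  γ = 1F
  δ = 0F

FinDiam-conn : Problem
FinDiam-conn = record { formula = FinDiamFormula ; Admissible = GraphCode }

-- The formula ∀^∞ n ∀ m ∃ k. x(n, m, k) = 0 is strictly dicomplete because the matrix of any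
-- other formula is primitive recursive in the instance, hence tabulated by some x.
-- FinDiam reduces to it because the matrix of FinDiam is monotone in the bound r, so that
-- ∃ r may be replaced by ∀^∞ r.  Conversely, x is turned into a graph with a component for
-- each (n, m): a path ("spine") of length n, and for each k with x(n, m, k) = 0 a hub adjacent
-- to the whole spine.  A component has diameter at most 2 if it has a hub and n otherwise.
-- A path of length above t + 2 either meets a hub or lies on a spine with n > t, which gives
-- the detour; and a path of length below n joining the ends of a spine must meet a hub.
--
-- In each reduction, the values that a witness chooses are found by primitive recursion from
-- those of the given witness alone, and the copies of the instance at the leaves can be
-- restored afterwards.  As a true formula has a witness (type-theoretic choice), the
-- equivalence of the two formulas need not be proved separately.

module Submission where

open import Defs
open import Data.Fin.Base using (Fin; zero; suc; toℕ; fromℕ<)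
open import Data.Fin.Patterns using (0F; 1F; 2F)
open import Data.Fin.Properties using (injective⇒≤; toℕ<n; toℕ-injective; toℕ-fromℕ<)
open import Data.List.Base using (List; []; _∷_; length)
open import Data.Nat.Base
  using (ℕ; zero; suc; pred; _+_; _*_; _∸_; _≤_; _<_; z≤n; s≤s; s≤s⁻¹; ⌊_/2⌋; ⌈_/2⌉; ∣_-_∣)
open import Data.Nat.Properties
open import Data.Product.Base using (∃-syntax; _×_; _,_; proj₁; proj₂)
open import Data.Sum.Base using (_⊎_; inj₁; inj₂)
open import Data.Vec.Base using (Vec; []; _∷_; lookup; tabulate)
open import Data.Vec.Properties using (tabulate∘lookup; lookup∘tabulate; tabulate-cong)
open import Data.Vec.Relation.Unary.All using (All; []; _∷_)
open import Function.Base using (_∘_; id)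
open import Function.Bundles using (_⇔_; mk⇔; module Equivalence)
open import Relation.Binary.Definitions using (Tri; tri<; tri≈; tri>)
open import Relation.Binary.PropositionalEquality
open import Relation.Nullary using (¬_; yes; no; contradiction)
open import Relation.Nullary.Decidable using (decidable-stable)

-- Cantor pairing and codes of lists.

fst snd : ℕ → ℕ
fst c = proj₁ (unpair c)
snd c = proj₂ (unpair c)

pair-suc : ∀ m n → pair m (suc n) ≡ suc (pair (suc m) n)
pair-suc m n = trans (cong (λ d → triangle d + suc n) (+-suc m n))
                     (+-suc (triangle (suc m + n)) n)

pair-zero : ∀ m → pair (suc m) 0 ≡ suc (pair 0 m)
pair-zero m rewrite +-identityʳ m | +-identityʳ (m + triangle m) = cong suc (+-comm m (triangle m))

pair-nextPair : ∀ q → pair (proj₁ (nextPair q)) (proj₂ (nextPair q)) ≡ suc (pair (proj₁ q) (proj₂ q))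
pair-nextPair (zero  , n) = pair-zero n
pair-nextPair (suc m , n) = pair-suc m n

pair-unpair : ∀ c → pair (fst c) (snd c) ≡ c
pair-unpair zero    = refl
pair-unpair (suc c) = trans (pair-nextPair (unpair c)) (cong suc (pair-unpair c))

unpair-pair : ∀ m n → unpair (pair m n) ≡ (m , n)
unpair-pair m n = onDiagonal (m + n) m n refl
  where
  -- The induction follows the enumeration backwards: `(m , suc n)` is preceded by `(suc m , n)` on
  -- the same diagonal, and `(suc m , 0)` by `(0 , m)` on the one before.
  onDiagonal : ∀ d m n → m + n ≡ d → unpair (pair m n) ≡ (m , n)
  onDiagonal d       m       (suc n) eq =
    trans (cong unpair (pair-suc m n))
          (cong nextPair (onDiagonal d (suc m) n (trans (sym (+-suc m n)) eq)))
  onDiagonal d       zero    zero    eq = refl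
  onDiagonal (suc d) (suc m) zero    eq =
    trans (cong unpair (pair-zero m))
          (cong nextPair (onDiagonal d zero m (trans (sym (+-identityʳ m)) (suc-injective eq))))

fst-pair : ∀ m n → fst (pair m n) ≡ m
fst-pair m n = cong proj₁ (unpair-pair m n)

snd-pair : ∀ m n → snd (pair m n) ≡ n
snd-pair m n = cong proj₂ (unpair-pair m n)

pair-injective : ∀ {c d} → fst c ≡ fst d → snd c ≡ snd d → c ≡ d
pair-injective {c} {d} p q = trans (sym (pair-unpair c)) (trans (cong₂ pair p q) (pair-unpair d))

snd≤pair : ∀ m n → n ≤ pair m n
snd≤pair m n = m≤n+m n (triangle (m + n))

snd≤ : ∀ c → snd c ≤ c
snd≤ c = subst (snd c ≤_) (pair-unpair c) (snd≤pair (fst c) (snd c))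

cons : ℕ → ℕ → ℕ
cons m c = suc (pair m c)

-- Every step passes from `suc c` to `snd c`, which is at most `c`, so any fuel not below the code
-- gives the same list. This turns the fuelled definition into the recursion equation `decode-suc`.
decodeWithin-fuel : ∀ f g c → c ≤ f → c ≤ g → decodeWithin f c ≡ decodeWithin g c
decodeWithin-fuel zero    zero    zero    _ _ = refl
decodeWithin-fuel zero    (suc g) zero    _ _ = refl
decodeWithin-fuel (suc f) zero    zero    _ _ = refl
decodeWithin-fuel (suc f) (suc g) zero    _ _ = refl
decodeWithin-fuel (suc f) (suc g) (suc c) (s≤s p) (s≤s q) =
  cong (fst c ∷_) (decodeWithin-fuel f g (snd c) (≤-trans (snd≤ c) p) (≤-trans (snd≤ c) q))

decode-suc : ∀ c → decode (suc c) ≡ fst c ∷ decode (snd c)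
decode-suc c = cong (fst c ∷_) (decodeWithin-fuel c (snd c) (snd c) (snd≤ c) ≤-refl)

decode-cons : ∀ m c → decode (cons m c) ≡ m ∷ decode c
decode-cons m c = trans (decode-suc (pair m c))
                        (cong₂ (λ h t → h ∷ decode t) (fst-pair m c) (snd-pair m c))

size : ℕ → ℕ
size c = length (decode c)

ent : ℕ → ℕ → ℕ
ent c i = entry (decode c) i

-- Primitive recursive expressions

natrec : ℕ → (ℕ → ℕ → ℕ) → ℕ → ℕ
natrec z s zero    = z
natrec z s (suc n) = s n (natrec z s n)

ifz : ℕ → ℕ → ℕ → ℕ
ifz zero    a b = a
ifz (suc _) a b = b

-- The program is polymorphic in the number of oracles, so the same function can be used inside any
-- relative computation.
record Programmable {m} (f : Vec ℕ m → ℕ) : Set where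
  field
    program : ∀ {k} → Rec k m
    correct : ∀ {k} (αs : Vec Baire k) xs → Eval αs program xs (f xs)

open Programmable

uncurry₁ : (ℕ → ℕ) → Vec ℕ 1 → ℕ
uncurry₁ f (x ∷ []) = f x

uncurry₂ : (ℕ → ℕ → ℕ) → Vec ℕ 2 → ℕ
uncurry₂ f (x ∷ y ∷ []) = f x y

-- Expressions in n number variables and k oracles.  Applying programmable functions
-- by name makes ⟦_⟧ₑ reduce to the intended Agda term.
data Exp (k : ℕ) : ℕ → Set where
  arg   : ∀ {n} → Fin n → Exp k n
  lit   : ∀ {n} → ℕ → Exp k n
  ask   : ∀ {n} → Fin k → Exp k n → Exp k n
  app₁  : ∀ {n f} → Programmable (uncurry₁ f) → Exp k n → Exp k n
  app₂  : ∀ {n f} → Programmable (uncurry₂ f) → Exp k n → Exp k n → Exp k n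
  ifzᵉ  : ∀ {n} → Exp k n → Exp k n → Exp k n → Exp k n
  rec   : ∀ {n} → Exp k n → Exp k (suc (suc n)) → Exp k n → Exp k n
  call  : ∀ {m n} → Exp k m → Vec (Exp k n) m → Exp k n

⟦_⟧ₑ : ∀ {k n} → Exp k n → Vec Baire k → Vec ℕ n → ℕ
⟦_⟧ₑ* : ∀ {k m n} → Vec (Exp k n) m → Vec Baire k → Vec ℕ n → Vec ℕ m

⟦ arg i ⟧ₑ              αs xs = lookup xs i
⟦ lit m ⟧ₑ              αs xs = m
⟦ ask i e ⟧ₑ            αs xs = lookup αs i (⟦ e ⟧ₑ αs xs)
⟦ app₁ {f = f} _ e ⟧ₑ   αs xs = f (⟦ e ⟧ₑ αs xs)
⟦ app₂ {f = f} _ d e ⟧ₑ αs xs = f (⟦ d ⟧ₑ αs xs) (⟦ e ⟧ₑ αs xs)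
⟦ ifzᵉ e a b ⟧ₑ         αs xs = ifz (⟦ e ⟧ₑ αs xs) (⟦ a ⟧ₑ αs xs) (⟦ b ⟧ₑ αs xs)
⟦ rec z s e ⟧ₑ          αs xs = natrec (⟦ z ⟧ₑ αs xs) (λ i y → ⟦ s ⟧ₑ αs (i ∷ y ∷ xs)) (⟦ e ⟧ₑ αs xs)
⟦ call e es ⟧ₑ          αs xs = ⟦ e ⟧ₑ αs (⟦ es ⟧ₑ* αs xs)

⟦ [] ⟧ₑ*     αs xs = []
⟦ e ∷ es ⟧ₑ* αs xs = ⟦ e ⟧ₑ αs xs ∷ ⟦ es ⟧ₑ* αs xs

⟦tabulate⟧ : ∀ {k m n} (f : Fin m → Exp k n) αs xs →
             ⟦ tabulate f ⟧ₑ* αs xs ≡ tabulate (λ i → ⟦ f i ⟧ₑ αs xs)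
⟦tabulate⟧ {m = zero}  f αs xs = refl
⟦tabulate⟧ {m = suc m} f αs xs = cong (⟦ f zero ⟧ₑ αs xs ∷_) (⟦tabulate⟧ (f ∘ suc) αs xs)

natrec-cong : ∀ {z s s′ m n} → (∀ i y → s i y ≡ s′ i y) → m ≡ n → natrec z s m ≡ natrec z s′ n
natrec-cong {m = zero}  eq refl = refl
natrec-cong {z} {s} {s′} {suc m} eq refl =
  trans (cong (s m) (natrec-cong {z} {s} {s′} {m} eq refl)) (eq m _)

under₂ : ∀ {n} → Fin n → Fin (suc (suc n))
under₂ i = suc (suc i)

litᴿ : ∀ {k n} → ℕ → Rec k n
litᴿ zero    = compᴿ zeroᴿ []
litᴿ (suc m) = compᴿ sucᴿ (litᴿ m ∷ [])

compile : ∀ {j k n} → Vec (Rec j 1) k → Exp k n → Rec j n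
compile* : ∀ {j k m n} → Vec (Rec j 1) k → Vec (Exp k n) m → Vec (Rec j n) m

compile os (arg i)      = projᴿ i
compile os (lit m)      = litᴿ m
compile os (ask i e)    = compᴿ (lookup os i) (compile os e ∷ [])
compile os (app₁ p e)   = compᴿ (program p) (compile os e ∷ [])
compile os (app₂ p d e) = compᴿ (program p) (compile os d ∷ compile os e ∷ [])
-- Case distinction is a primitive recursion whose step forgets the counter and the previous value;
-- `under₂` skips these two.
compile os (ifzᵉ e a b) =
  compᴿ (primᴿ (compile os a) (compᴿ (compile os b) (tabulate (projᴿ ∘ under₂))))
        (compile os e ∷ tabulate projᴿ)
compile os (rec z s e)  = compᴿ (primᴿ (compile os z) (compile os s)) (compile os e ∷ tabulate projᴿ)
compile os (call e es)  = compᴿ (compile os e) (compile* os es)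

compile* os []       = []
compile* os (e ∷ es) = compile os e ∷ compile* os es

evalComp₁ : ∀ {k n} {αs : Vec Baire k} {f : Rec k 1} {g : Rec k n} {xs y z} →
            Eval αs g xs y → Eval αs f (y ∷ []) z → Eval αs (compᴿ f (g ∷ [])) xs z
evalComp₁ p q = evalComp (_ ∷ []) (λ { zero → p }) q

evalLit : ∀ {k n} (αs : Vec Baire k) (xs : Vec ℕ n) m → Eval αs (litᴿ m) xs m
evalLit αs xs zero    = evalComp [] (λ ()) evalZero
evalLit αs xs (suc m) = evalComp₁ (evalLit αs xs m) evalSuc

evalProjs : ∀ {k m n} (αs : Vec Baire k) (ρ : Fin m → Fin n) {xs : Vec ℕ n} (ys : Vec ℕ m) →
            (∀ i → lookup xs (ρ i) ≡ lookup ys i) →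
            ∀ i → Eval αs (lookup (tabulate (projᴿ ∘ ρ)) i) xs (lookup ys i)
evalProjs αs ρ {xs} ys eq i =
  subst₂ (λ g y → Eval αs g xs y) (sym (lookup∘tabulate (projᴿ ∘ ρ) i)) (eq i) (evalProj (ρ i))

evalNatrec : ∀ {k n} {αs : Vec Baire k} {g : Rec k n} {h xs z s} →
             Eval αs g xs z → (∀ i y → Eval αs h (i ∷ y ∷ xs) (s i y)) →
             ∀ m → Eval αs (primᴿ g h) (m ∷ xs) (natrec z s m)
evalNatrec p q zero    = evalPrim0 p
evalNatrec p q (suc m) = evalPrimS (evalNatrec p q m) (q m _)

natrec-const : ∀ a b m → natrec a (λ _ _ → b) m ≡ ifz m a b
natrec-const a b zero    = refl
natrec-const a b (suc m) = refl

module _ {j k} {os : Vec (Rec j 1) k} {βs : Vec Baire j} {αs : Vec Baire k}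
         (oracles : ∀ i → Computes (lookup os i) βs (lookup αs i)) where

  evalAll : ∀ {m n} {g : Rec j n} {gs : Vec (Rec j n) m} {xs y ys} → Eval βs g xs y →
            (∀ i → Eval βs (lookup gs i) xs (lookup ys i)) →
            ∀ i → Eval βs (lookup (g ∷ gs) i) xs (lookup (y ∷ ys) i)
  evalAll p q zero    = p
  evalAll p q (suc i) = q i

  evalCompile : ∀ {n} (e : Exp k n) xs → Eval βs (compile os e) xs (⟦ e ⟧ₑ αs xs)
  evalCompile* : ∀ {m n} (es : Vec (Exp k n) m) xs i →
                 Eval βs (lookup (compile* os es) i) xs (lookup (⟦ es ⟧ₑ* αs xs) i)

  evalCompile (arg i)      xs = evalProj i
  evalCompile (lit m)      xs = evalLit βs xs m
  evalCompile (ask i e)    xs = evalComp₁ (evalCompile e xs) (oracles i _)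
  evalCompile (app₁ p e)   xs = evalComp₁ (evalCompile e xs) (correct p βs _)
  evalCompile (app₂ p d e) xs =
    evalComp (_ ∷ _ ∷ []) (evalAll (evalCompile d xs) (evalAll {ys = []} (evalCompile e xs) (λ ())))
             (correct p βs _)
  evalCompile (ifzᵉ e a b) xs =
    evalComp (_ ∷ xs) (evalAll (evalCompile e xs) (evalProjs βs id xs (λ _ → refl)))
      (subst (Eval βs _ _) (natrec-const _ _ (⟦ e ⟧ₑ αs xs))
        (evalNatrec (evalCompile a xs)
          (λ _ _ → evalComp xs (evalProjs βs under₂ xs (λ _ → refl)) (evalCompile b xs))
          (⟦ e ⟧ₑ αs xs)))
  evalCompile (rec z s e)  xs =
    evalComp (_ ∷ xs) (evalAll (evalCompile e xs) (evalProjs βs id xs (λ _ → refl)))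
      (evalNatrec (evalCompile z xs) (λ i y → evalCompile s (i ∷ y ∷ xs)) (⟦ e ⟧ₑ αs xs))
  evalCompile (call e es)  xs = evalComp (⟦ es ⟧ₑ* αs xs) (evalCompile* es xs) (evalCompile e _)

  evalCompile* (e ∷ es) xs zero    = evalCompile e xs
  evalCompile* (e ∷ es) xs (suc i) = evalCompile* es xs i

programmable : ∀ {m f} (e : Exp 0 m) → (∀ xs → ⟦ e ⟧ₑ [] xs ≡ f xs) → Programmable f
programmable e eq = record
  { program = compile [] e
  ; correct = λ αs xs → subst (Eval αs _ xs) (eq xs) (evalCompile (λ ()) e xs)
  }

-- Programmable functions

sucᶜ : Programmable (uncurry₁ suc)
sucᶜ = record { program = sucᴿ ; correct = λ { αs (x ∷ []) → evalSuc } }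

predᶜ : Programmable (uncurry₁ pred)
predᶜ = programmable (rec (lit 0) (arg 0F) (arg 0F))
  λ { (zero ∷ []) → refl ; (suc x ∷ []) → refl }

addᶜ : Programmable (uncurry₂ _+_)
addᶜ = programmable (rec (arg 1F) (app₁ sucᶜ (arg 1F)) (arg 0F)) λ { (x ∷ y ∷ []) → eq x y }
  where
  eq : ∀ x y → natrec y (λ _ → suc) x ≡ x + y
  eq zero    y = refl
  eq (suc x) y = cong suc (eq x y)

mulᶜ : Programmable (uncurry₂ _*_)
mulᶜ = programmable (rec (lit 0) (app₂ addᶜ (arg 3F) (arg 1F)) (arg 0F)) λ { (x ∷ y ∷ []) → eq x y }
  where
  3F = suc 2F
  eq : ∀ x y → natrec 0 (λ _ z → y + z) x ≡ x * y
  eq zero    y = refl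
  eq (suc x) y = cong (y +_) (eq x y)

monusᶜ : Programmable (uncurry₂ _∸_)
monusᶜ = programmable (rec (arg 0F) (app₁ predᶜ (arg 1F)) (arg 1F)) λ { (x ∷ y ∷ []) → eq x y }
  where
  eq : ∀ x y → natrec x (λ _ → pred) y ≡ x ∸ y
  eq x zero    = refl
  eq x (suc y) = trans (cong pred (eq x y)) (pred[m∸n]≡m∸[1+n] x y)

distᶜ : Programmable (uncurry₂ ∣_-_∣)
distᶜ = programmable (app₂ addᶜ (app₂ monusᶜ (arg 0F) (arg 1F)) (app₂ monusᶜ (arg 1F) (arg 0F)))
  λ { (x ∷ y ∷ []) → eq x y }
  where
  eq : ∀ x y → (x ∸ y) + (y ∸ x) ≡ ∣ x - y ∣
  eq zero    zero    = refl
  eq zero    (suc y) = refl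
  eq (suc x) zero    = +-identityʳ (suc x)
  eq (suc x) (suc y) = eq x y

triangleᶜ : Programmable (uncurry₁ triangle)
triangleᶜ = programmable (rec (lit 0) (app₂ addᶜ (app₁ sucᶜ (arg 0F)) (arg 1F)) (arg 0F))
  λ { (x ∷ []) → eq x }
  where
  eq : ∀ x → natrec 0 (λ i y → suc i + y) x ≡ triangle x
  eq zero    = refl
  eq (suc x) = cong (suc x +_) (eq x)

pairᶜ : Programmable (uncurry₂ pair)
pairᶜ = programmable (app₂ addᶜ (app₁ triangleᶜ (app₂ addᶜ (arg 0F) (arg 1F))) (arg 1F))
  λ { (x ∷ y ∷ []) → refl }

-- A single number that primitive recursion can carry in place of the pair `unpair c`; together with
-- `c` it determines both components.
diagonal : ℕ → ℕ
diagonal c = fst c + snd c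

-- The codes on diagonal `d` begin with `triangle d`, so passing from `c` to `suc c` enters the next
-- diagonal exactly when `suc c` has reached `triangle (suc d)`. Truncated subtraction tests this.
diagonal-suc : ∀ c → let d = diagonal c in ifz (triangle (suc d) ∸ suc c) (suc d) d ≡ diagonal (suc c)
diagonal-suc c with unpair c | pair-unpair c
... | zero  , n | refl = trans (cong (λ z → ifz z (suc n) n) overflow) (cong suc (sym (+-identityʳ n)))
  where
  overflow : n + triangle n ∸ (triangle n + n) ≡ 0
  overflow = m≤n⇒m∸n≡0 (≤-reflexive (+-comm n (triangle n)))
... | suc m , n | refl = trans (cong (λ z → ifz z (suc d) d) room) (sym (+-suc m n))
  where
  d = suc (m + n)
  room : d + triangle d ∸ (triangle d + n) ≡ suc m
  room = begin
    d + triangle d ∸ (triangle d + n) ≡⟨ cong (_∸ (triangle d + n)) (+-comm d (triangle d)) ⟩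
    triangle d + d ∸ (triangle d + n) ≡⟨ [m+n]∸[m+o]≡n∸o (triangle d) d n ⟩
    d ∸ n                             ≡⟨ m+n∸n≡m (suc m) n ⟩
    suc m                             ∎
    where open ≡-Reasoning

diagonalᶜ : Programmable (uncurry₁ diagonal)
diagonalᶜ = programmable
  (rec (lit 0)
       (ifzᵉ (app₂ monusᶜ (app₁ triangleᶜ (app₁ sucᶜ (arg 1F))) (app₁ sucᶜ (arg 0F)))
             (app₁ sucᶜ (arg 1F)) (arg 1F))
       (arg 0F))
  λ { (c ∷ []) → eq c }
  where
  eq : ∀ c → natrec 0 (λ i y → ifz (triangle (suc y) ∸ suc i) (suc y) y) c ≡ diagonal c
  eq zero    = refl
  eq (suc c) rewrite eq c = diagonal-suc c

sndᶜ : Programmable (uncurry₁ snd)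
sndᶜ = programmable (app₂ monusᶜ (arg 0F) (app₁ triangleᶜ (app₁ diagonalᶜ (arg 0F))))
  λ { (c ∷ []) → trans (cong (_∸ triangle (diagonal c)) (sym (pair-unpair c)))
                       (m+n∸m≡n (triangle (diagonal c)) (snd c)) }

fstᶜ : Programmable (uncurry₁ fst)
fstᶜ = programmable (app₂ monusᶜ (app₁ diagonalᶜ (arg 0F)) (app₁ sndᶜ (arg 0F)))
  λ { (c ∷ []) → m+n∸n≡m (fst c) (snd c) }

consᶜ : Programmable (uncurry₂ cons)
consᶜ = programmable (app₁ sucᶜ (app₂ pairᶜ (arg 0F) (arg 1F))) λ { (x ∷ y ∷ []) → refl }

drop : ℕ → ℕ → ℕ
drop zero    c = c
drop (suc i) c = snd (pred (drop i c))

drop-zero : ∀ i → drop i 0 ≡ 0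
drop-zero zero    = refl
drop-zero (suc i) rewrite drop-zero i = refl

drop-suc : ∀ i c → drop (suc i) c ≡ drop i (snd (pred c))
drop-suc zero    c = refl
drop-suc (suc i) c = cong (snd ∘ pred) (drop-suc i c)

dropᶜ : Programmable (uncurry₂ drop)
dropᶜ = programmable (rec (arg 1F) (app₁ sndᶜ (app₁ predᶜ (arg 1F))) (arg 0F)) λ { (i ∷ c ∷ []) → eq i c }
  where
  eq : ∀ i c → natrec c (λ _ y → snd (pred y)) i ≡ drop i c
  eq zero    c = refl
  eq (suc i) c = cong (snd ∘ pred) (eq i c)

entᶜ : Programmable (uncurry₂ ent)
entᶜ = programmable (app₁ fstᶜ (app₁ predᶜ (app₂ dropᶜ (arg 1F) (arg 0F)))) λ { (c ∷ i ∷ []) → eq i c }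
  where
  eq : ∀ i c → fst (pred (drop i c)) ≡ ent c i
  eq i       zero    rewrite drop-zero i = refl
  eq zero    (suc c) = refl
  eq (suc i) (suc c) = begin
    fst (pred (drop (suc i) (suc c))) ≡⟨ cong (fst ∘ pred) (drop-suc i (suc c)) ⟩
    fst (pred (drop i (snd c)))       ≡⟨ eq i (snd c) ⟩
    ent (snd c) i                     ≡⟨ cong (λ l → entry l (suc i)) (sym (decode-suc c)) ⟩
    ent (suc c) (suc i)               ∎
    where open ≡-Reasoning

-- The length is the number of `i` for which `drop i c` is not the empty list. It suffices to count
-- below `c`, because `c` is also the fuel of `decode`.
sizeᶜ : Programmable (uncurry₁ size)
sizeᶜ = programmable
  (rec (lit 0) (app₂ addᶜ (ifzᵉ (app₂ dropᶜ (arg 0F) (arg 2F)) (lit 0) (lit 1)) (arg 1F)) (arg 0F))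
  λ { (c ∷ []) → within c c }
  where
  count : ℕ → ℕ → ℕ
  count f c = natrec 0 (λ i y → ifz (drop i c) 0 1 + y) f
  -- `count` splits off its last summand, `decodeWithin` its first entry; this moves the split to
  -- the first summand.
  count-suc : ∀ f c → count (suc f) c ≡ ifz c 0 1 + count f (snd (pred c))
  count-suc zero    c = refl
  count-suc (suc f) c = begin
    ifz (drop (suc f) c) 0 1 + count (suc f) c
      ≡⟨ cong₂ (λ d y → ifz d 0 1 + y) (drop-suc f c) (count-suc f c) ⟩
    a + (ifz c 0 1 + count f c′)
      ≡⟨ x∙yz≈y∙xz a (ifz c 0 1) (count f c′) ⟩
    ifz c 0 1 + (a + count f c′) ∎
    where
    open ≡-Reasoning
    c′ = snd (pred c)
    a  = ifz (drop f c′) 0 1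
    x∙yz≈y∙xz : ∀ x y z → x + (y + z) ≡ y + (x + z)
    x∙yz≈y∙xz x y z rewrite sym (+-assoc x y z) | +-comm x y = +-assoc y x z
  within : ∀ f c → count f c ≡ length (decodeWithin f c)
  within zero    c       = refl
  within (suc f) zero    = trans (count-suc f 0) (trans (within f 0) (empty f))
    where
    empty : ∀ f → length (decodeWithin f 0) ≡ 0
    empty zero    = refl
    empty (suc f) = refl
  within (suc f) (suc c) = trans (count-suc f (suc c)) (cong suc (within f (snd c)))

-- Interleaved sequences.

⊕-even : ∀ α β j → (α ⊕ β) (j + j) ≡ α j
⊕-even α β zero    = refl
⊕-even α β (suc j) = trans (cong (α ⊕ β) (cong suc (+-suc j j))) (⊕-even (tail α) (tail β) j)

⊕-odd : ∀ α β j → (α ⊕ β) (suc (j + j)) ≡ β j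
⊕-odd α β zero    = refl
⊕-odd α β (suc j) = trans (cong (λ i → (α ⊕ β) (suc (suc i))) (+-suc j j)) (⊕-odd (tail α) (tail β) j)

parity : ℕ → ℕ
parity zero          = 0
parity (suc zero)    = 1
parity (suc (suc n)) = parity n

parityᶜ : Programmable (uncurry₁ parity)
parityᶜ = programmable (rec (lit 0) (app₂ monusᶜ (lit 1) (arg 1F)) (arg 0F)) λ { (n ∷ []) → eq n }
  where
  eq : ∀ n → natrec 0 (λ _ y → 1 ∸ y) n ≡ parity n
  flip : ∀ n → 1 ∸ parity n ≡ parity (suc n)
  flip zero          = refl
  flip (suc zero)    = refl
  flip (suc (suc n)) = flip n
  eq zero    = refl
  eq (suc n) = trans (cong (1 ∸_) (eq n)) (flip n)

-- `⌊ suc n /2⌋` is `⌈ n /2⌉`, that is, `n ∸ ⌊ n /2⌋`, which gives a recursion without parity.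
halfᶜ : Programmable (uncurry₁ ⌊_/2⌋)
halfᶜ = programmable (rec (lit 0) (app₂ monusᶜ (arg 0F) (arg 1F)) (arg 0F)) λ { (n ∷ []) → eq n }
  where
  eq : ∀ n → natrec 0 _∸_ n ≡ ⌊ n /2⌋
  eq zero    = refl
  eq (suc n) = begin
    n ∸ natrec 0 _∸_ n                     ≡⟨ cong (n ∸_) (eq n) ⟩
    n ∸ ⌊ n /2⌋                            ≡⟨ cong (_∸ ⌊ n /2⌋) (sym (⌊n/2⌋+⌈n/2⌉≡n n)) ⟩
    ⌊ n /2⌋ + ⌈ n /2⌉ ∸ ⌊ n /2⌋            ≡⟨ m+n∸m≡n ⌊ n /2⌋ ⌈ n /2⌉ ⟩
    ⌈ n /2⌉                                ∎
    where open ≡-Reasoning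

⊕-ifz : ∀ α β n → ifz (parity n) (α ⌊ n /2⌋) (β ⌊ n /2⌋) ≡ (α ⊕ β) n
⊕-ifz α β zero          = refl
⊕-ifz α β (suc zero)    = refl
⊕-ifz α β (suc (suc n)) = ⊕-ifz (tail α) (tail β) n

-- Computability of instances

run : Exp 1 1 → Baire → Baire
run e α n = ⟦ e ⟧ₑ (α ∷ []) (n ∷ [])

Computable-≗ : ∀ {f g} → f ≗ g → Computable f → Computable g
Computable-≗ eq (e , p) = e , λ n → subst (Eval [] e _) (eq n) (p n)

computable-image : ∀ {k} {αs : Vec Baire k} (e : Exp k 1) → All Computable αs →
                   Computable (λ n → ⟦ e ⟧ₑ αs (n ∷ []))
computable-image e cs = compile (programs cs) e , λ n → evalCompile (computes cs) e (n ∷ [])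
  where
  programs : ∀ {k} {αs : Vec Baire k} → All Computable αs → Vec (Rec 0 1) k
  programs []             = []
  programs ((e , _) ∷ cs) = e ∷ programs cs
  computes : ∀ {k} {αs : Vec Baire k} (cs : All Computable αs) i →
             Computes (lookup (programs cs) i) [] (lookup αs i)
  computes ((_ , p) ∷ cs) zero    = p
  computes (_ ∷ cs)       (suc i) = computes cs i

computable-∷ᵇ : ∀ {f} m → Computable f → Computable (m ∷ᵇ f)
computable-∷ᵇ m c =
  Computable-≗ (λ { zero → refl ; (suc n) → refl })
    (computable-image (ifzᵉ (arg 0F) (lit m) (ask 0F (app₁ predᶜ (arg 0F)))) (c ∷ []))

computable-⊕ : ∀ {f g} → Computable f → Computable g → Computable (f ⊕ g)
computable-⊕ {f} {g} c d =
  Computable-≗ (⊕-ifz f g)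
    (computable-image (ifzᵉ (app₁ parityᶜ (arg 0F)) (ask 0F half) (ask 1F half)) (c ∷ d ∷ []))
  where half = app₁ halfᶜ (arg 0F)

computable-code : ∀ {a b} (ns : Vec ℕ a) {fs : Vec Baire b} → All Computable fs →
                  Computable (code (ns , fs))
computable-code []       []              = computable-image (lit 0) []
computable-code []       (c ∷ [])        = c
computable-code []       (c ∷ cs@(_ ∷ _)) = computable-⊕ c (computable-code [] cs)
computable-code (n ∷ ns) cs              = computable-∷ᵇ n (computable-code ns cs)

-- Realisers

-- Realises drops from Witness the demand that the leaves repeat the instance, so it
-- only mentions the values chosen for the quantifiers.
Realises : ∀ {b Q̄ a} → Formula b Q̄ a → Baire → Tuple a b → Set
Realises (matrix θ)    α x = ⟦ θ ⟧ x
Realises (quant `∃ φ)  α x = Realises φ (tail α) (head α ◂ x)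
Realises (quant `∀ φ)  α x = ∀ n → Realises φ (section α n) (n ◂ x)
Realises (quant `∃∞ φ) α x =
  ∀ n → n ≤ head (section α n) × Realises φ (tail (section α n)) (head (section α n) ◂ x)
Realises (quant `∀∞ φ) α x = ∀ n → head α ≤ n → Realises φ (section (tail α) n) (n ◂ x)

witness⇒realises : ∀ {b Q̄ a} (φ : Formula b Q̄ a) {α x} → Witness φ α x → Realises φ α x
witness⇒realises (matrix θ)    (_ , p) = p
witness⇒realises (quant `∃ φ)  w       = witness⇒realises φ w
witness⇒realises (quant `∀ φ)  w n     = witness⇒realises φ (w n)
witness⇒realises (quant `∃∞ φ) w n     = proj₁ (w n) , witness⇒realises φ (proj₂ (w n))
witness⇒realises (quant `∀∞ φ) w n p   = witness⇒realises φ (w n p)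

realises⇒true : ∀ {b Q̄ a} (φ : Formula b Q̄ a) {α x} → Realises φ α x → True φ x
realises⇒true (matrix θ)    r       = r
realises⇒true (quant `∃ φ)  r       = _ , realises⇒true φ r
realises⇒true (quant `∀ φ)  r n     = realises⇒true φ (r n)
realises⇒true (quant `∃∞ φ) r n     = _ , proj₁ (r n) , realises⇒true φ (proj₂ (r n))
realises⇒true (quant `∀∞ φ) r       = _ , λ n p → realises⇒true φ (r n p)

Realises-≗ : ∀ {b Q̄ a} (φ : Formula b Q̄ a) {α β x} → α ≗ β → Realises φ α x → Realises φ β x
Realises-≗ (matrix θ)    eq r = r
Realises-≗ (quant `∃ φ) {x = x} eq r =
  subst (λ t → Realises φ _ (t ◂ x)) (eq 0) (Realises-≗ φ (eq ∘ suc) r)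
Realises-≗ (quant `∀ φ)  eq r n = Realises-≗ φ (eq ∘ pair n) (r n)
Realises-≗ (quant `∃∞ φ) {x = x} eq r n =
  subst (n ≤_) (eq _) (proj₁ (r n)) ,
  subst (λ t → Realises φ _ (t ◂ x)) (eq _) (Realises-≗ φ (λ k → eq (pair n (suc k))) (proj₂ (r n)))
Realises-≗ (quant `∀∞ φ) eq r n p =
  Realises-≗ φ (λ k → eq (suc (pair n k))) (r n (subst (_≤ n) (sym (eq 0)) p))

join : (ℕ → Baire) → Baire
join f i = f (fst i) (snd i)

section-join : ∀ f n → section (join f) n ≗ f n
section-join f n k = cong₂ f (fst-pair n k) (snd-pair n k)

Realiser : ∀ {b Q̄ a} → Formula b Q̄ a → Tuple a b → Set
Realiser φ x = ∃[ α ] Realises φ α x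

realiser-∀ : ∀ {b Q̄ a} {φ : Formula b Q̄ (suc a)} {x} → (∀ n → Realiser φ (n ◂ x)) →
             Realiser (quant `∀ φ) x
realiser-∀ {φ = φ} r =
  join (proj₁ ∘ r) , λ n → Realises-≗ φ (sym ∘ section-join (proj₁ ∘ r) n) (proj₂ (r n))

-- A proof of truth contains functions choosing the values, which are collected into one sequence.
-- No computability is claimed for it: it serves to carry truth across a reduction.
true⇒realiser : ∀ {b Q̄ a} (φ : Formula b Q̄ a) {x} → True φ x → Realiser φ x
true⇒realiser (matrix θ)    t       = (λ _ → 0) , t
true⇒realiser (quant `∃ φ)  (n , t) = let α , r = true⇒realiser φ t in n ∷ᵇ α , r
true⇒realiser (quant `∀ φ)  t       = realiser-∀ {φ = φ} (λ n → true⇒realiser φ (t n))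
true⇒realiser {b} {a = a} (quant `∃∞ φ) {x} t = join (proj₁ ∘ r) , λ n →
  let eq = sym ∘ section-join (proj₁ ∘ r) n ; p , q = proj₂ (r n) in
  subst (n ≤_) (eq 0) p , subst (λ m → Realises φ (tail (section (join (proj₁ ∘ r)) n)) (m ◂ x)) (eq 0)
                            (Realises-≗ φ (eq ∘ suc) q)
  where
  r : ∀ n → ∃[ α ] n ≤ head α × Realises φ (tail α) (head α ◂ x)
  r n = let m , n≤m , u = t n ; α , q = true⇒realiser φ u in m ∷ᵇ α , n≤m , q
true⇒realiser (quant `∀∞ φ) {x} (m , t) =
  m ∷ᵇ join (proj₁ ∘ r) , λ n p → Realises-≗ φ (sym ∘ section-join (proj₁ ∘ r) n) (proj₂ (r n) p)
  where
  r : ∀ n → ∃[ α ] (m ≤ n → Realises φ α (n ◂ x))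
  -- Below the threshold nothing is required, so any sequence will do there.
  r n with m ≤? n
  ... | yes p = let α , q = true⇒realiser φ (t n p) in α , λ _ → q
  ... | no ¬p = (λ _ → 0) , λ p → contradiction p ¬p

-- Restoring the leaves of a witness.

Witness-≗ : ∀ {b Q̄ a} (φ : Formula b Q̄ a) {α β x} → α ≗ β → Witness φ α x → Witness φ β x
Witness-≗ (matrix θ)    eq (p , r) = (λ n → trans (sym (eq n)) (p n)) , r
Witness-≗ (quant `∃ φ) {x = x} eq r =
  subst (λ t → Witness φ _ (t ◂ x)) (eq 0) (Witness-≗ φ (eq ∘ suc) r)
Witness-≗ (quant `∀ φ)  eq r n = Witness-≗ φ (eq ∘ pair n) (r n)
Witness-≗ (quant `∃∞ φ) {x = x} eq r n =
  subst (n ≤_) (eq _) (proj₁ (r n)) ,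
  subst (λ t → Witness φ _ (t ◂ x)) (eq _) (Witness-≗ φ (λ k → eq (pair n (suc k))) (proj₂ (r n)))
Witness-≗ (quant `∀∞ φ) eq r n p =
  Witness-≗ φ (λ k → eq (suc (pair n k))) (r n (subst (_≤ n) (sym (eq 0)) p))

-- `c` codes the instance extended by the values bound so far. At a leaf it replaces whatever the
-- realiser holds there, and is the copy that `Witness` demands.
fill : Pattern → Baire → Baire → Baire
fill []        α c = c
fill (`∃ ∷ Q̄)  α c = head α ∷ᵇ fill Q̄ (tail α) (head α ∷ᵇ c)
fill (`∀ ∷ Q̄)  α c = join λ n → fill Q̄ (section α n) (n ∷ᵇ c)
fill (`∃∞ ∷ Q̄) α c = join λ n → let β = section α n in head β ∷ᵇ fill Q̄ (tail β) (head β ∷ᵇ c)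
fill (`∀∞ ∷ Q̄) α c = head α ∷ᵇ join λ n → fill Q̄ (section (tail α) n) (n ∷ᵇ c)

realises⇒witness : ∀ {b Q̄ a} (φ : Formula b Q̄ a) {α x} → Realises φ α x →
                   Witness φ (fill Q̄ α (code x)) x
realises⇒witness (matrix θ)   r = (λ _ → refl) , r
realises⇒witness (quant `∃ φ) r = realises⇒witness φ r
realises⇒witness {Q̄ = _ ∷ Q̄} (quant `∀ φ) {α} {x} r n =
  Witness-≗ φ (sym ∘ section-join (λ n → fill Q̄ (section α n) (n ∷ᵇ code x)) n)
    (realises⇒witness φ (r n))
realises⇒witness {Q̄ = _ ∷ Q̄} (quant `∃∞ φ) {α} {x} r n =
  subst (n ≤_) (eq 0) (proj₁ (r n)) ,
  subst (λ t → Witness φ (tail (section (fill (`∃∞ ∷ Q̄) α (code x)) n)) (t ◂ x)) (eq 0)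
    (Witness-≗ φ (eq ∘ suc) (realises⇒witness φ (proj₂ (r n))))
  where
  eq : fill (`∃ ∷ Q̄) (section α n) (code x) ≗ section (fill (`∃∞ ∷ Q̄) α (code x)) n
  eq = sym ∘ section-join (λ n → fill (`∃ ∷ Q̄) (section α n) (code x)) n
realises⇒witness {Q̄ = _ ∷ Q̄} (quant `∀∞ φ) {α} {x} r n p =
  Witness-≗ φ (sym ∘ section-join (λ n → fill Q̄ (section (tail α) n) (n ∷ᵇ code x)) n)
    (realises⇒witness φ (r n p))

-- A sequence given by an expression with a hole for its argument.
Seq : Set
Seq = Exp 2 1 → Exp 2 1

prepend : Exp 2 1 → Seq → Seq
prepend t A e = ifzᵉ e t (A (app₁ predᶜ e))

tailˢ : Seq → Seq
tailˢ A e = A (app₁ sucᶜ e)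

sectionˢ : Seq → Exp 2 1 → Seq
sectionˢ A n e = A (app₂ pairᶜ n e)

joinˢ : (Exp 2 1 → Seq) → Seq
joinˢ A e = A (app₁ fstᶜ e) (app₁ sndᶜ e)

-- The pattern is fixed, so the recursion of `fill` is unrolled into one expression: `joinˢ` splits
-- the argument and `sectionˢ` pairs it again.
fillˢ : Pattern → Seq → Seq → Seq
fillˢ []        A C = C
fillˢ (`∃ ∷ Q̄)  A C = prepend (A (lit 0)) (fillˢ Q̄ (tailˢ A) (prepend (A (lit 0)) C))
fillˢ (`∀ ∷ Q̄)  A C = joinˢ λ n → fillˢ Q̄ (sectionˢ A n) (prepend n C)
fillˢ (`∃∞ ∷ Q̄) A C = joinˢ λ n → let B = sectionˢ A n in
                       prepend (B (lit 0)) (fillˢ Q̄ (tailˢ B) (prepend (B (lit 0)) C))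
fillˢ (`∀∞ ∷ Q̄) A C = prepend (A (lit 0)) (joinˢ λ n → fillˢ Q̄ (sectionˢ (tailˢ A) n) (prepend n C))

module _ (αs : Vec Baire 2) (xs : Vec ℕ 1) where

  Represents : Seq → Baire → Set
  Represents A α = ∀ e → ⟦ A e ⟧ₑ αs xs ≡ α (⟦ e ⟧ₑ αs xs)

  prepend-represents : ∀ t A m α → ⟦ t ⟧ₑ αs xs ≡ m → Represents A α →
                       Represents (prepend t A) (m ∷ᵇ α)
  prepend-represents t A m α eq R e with ⟦ e ⟧ₑ αs xs | R (app₁ predᶜ e)
  ... | zero  | _ = eq
  ... | suc n | r = r

  fill-represents : ∀ Q̄ A C α c → Represents A α → Represents C c →
                    Represents (fillˢ Q̄ A C) (fill Q̄ α c)
  fill-represents []        A C α c R S = S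
  fill-represents (`∃ ∷ Q̄)  A C α c R S =
    prepend-represents t (fillˢ Q̄ (tailˢ A) (prepend t C)) _
      (fill Q̄ (tail α) (head α ∷ᵇ c)) (R (lit 0))
      (fill-represents Q̄ _ _ _ _ (λ e → R (app₁ sucᶜ e)) (prepend-represents t C _ c (R (lit 0)) S))
    where t = A (lit 0)
  fill-represents (`∀ ∷ Q̄)  A C α c R S e =
    fill-represents Q̄ _ _ _ _ (λ d → R (app₂ pairᶜ (app₁ fstᶜ e) d))
      (prepend-represents (app₁ fstᶜ e) C _ c refl S) (app₁ sndᶜ e)
  fill-represents (`∃∞ ∷ Q̄) A C α c R S e =
    prepend-represents t (fillˢ Q̄ (tailˢ B) (prepend t C)) _
      (fill Q̄ (tail β) (head β ∷ᵇ c)) (R (app₂ pairᶜ (app₁ fstᶜ e) (lit 0)))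
      (fill-represents Q̄ _ _ _ _ (λ d → R (app₂ pairᶜ (app₁ fstᶜ e) (app₁ sucᶜ d)))
        (prepend-represents t C _ c (R (app₂ pairᶜ (app₁ fstᶜ e) (lit 0))) S))
      (app₁ sndᶜ e)
    where
    B = sectionˢ A (app₁ fstᶜ e)
    t = B (lit 0)
    β = section α (⟦ app₁ fstᶜ e ⟧ₑ αs xs)
  fill-represents (`∀∞ ∷ Q̄) A C α c R S =
    prepend-represents (A (lit 0)) (joinˢ λ n → fillˢ Q̄ (sectionˢ (tailˢ A) n) (prepend n C)) _
      (join λ n → fill Q̄ (section (tail α) n) (n ∷ᵇ c)) (R (lit 0)) λ e →
      fill-represents Q̄ _ _ _ _ (λ d → R (app₁ sucᶜ (app₂ pairᶜ (app₁ fstᶜ e) d)))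
        (prepend-represents (app₁ fstᶜ e) C _ c refl S) (app₁ sndᶜ e)

fillᵉ : Pattern → Exp 2 1
fillᵉ Q̄ = fillˢ Q̄ (ask 0F) (ask 1F) (arg 0F)

evalFill : ∀ {j} {βs : Vec Baire j} {p q α c} Q̄ → Computes p βs α → Computes q βs c →
           Computes (compile (p ∷ q ∷ []) (fillᵉ Q̄)) βs (fill Q̄ α c)
evalFill {βs = βs} {α = α} {c} Q̄ P Q n =
  subst (Eval βs _ _)
    (fill-represents (α ∷ c ∷ []) (n ∷ []) Q̄ (ask 0F) (ask 1F) α c (λ _ → refl) (λ _ → refl) (arg 0F))
    (evalCompile {αs = α ∷ c ∷ []} (λ { 0F → P ; 1F → Q }) (fillᵉ Q̄) (n ∷ []))

-- Reductions given by maps of realisers.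

open Problem

compile₁ : ∀ {j} → Fin j → Exp 1 1 → Rec j 1
compile₁ i = compile (oracleᴿ i ∷ [])

evalCompile₁ : ∀ {j} {βs : Vec Baire j} i e → Computes (compile₁ i e) βs (run e (lookup βs i))
evalCompile₁ i e n = evalCompile (λ { 0F m → evalOracle i }) e (n ∷ [])

-- A realiser fixes a witness except for its leaves, so `s₋` and `s₊` read only the given realiser.
-- `fillᵉ` then restores the leaves, from `η` applied to the instance for `r₋` and from the instance
-- itself for `r₊`.
reduction : ∀ {P Q} (η s₋ s₊ : Exp 1 1) →
  (∀ x → Instance P x →
   ∃[ y ] Instance Q y
     × run η (code x) ≗ code y
     × (∀ α → Realises (formula P) α x → Realises (formula Q) (run s₋ α) y)
     × (∀ α → Realises (formula Q) α y → Realises (formula P) (run s₊ α) x)) →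
  ReducesVia (compile₁ 0F η) P Q
reduction {P} {Q} η s₋ s₊ hyp =
  compile (compile₁ 0F s₋ ∷ compile₁ 1F η ∷ []) (fillᵉ (prefix Q)) ,
  compile (compile₁ 0F s₊ ∷ oracleᴿ 1F ∷ []) (fillᵉ (prefix P)) ,
  λ x inst → let y , inst′ , eq , to , from = hyp x inst in
    y , inst′ , (λ n → subst (Eval _ _ _) (eq n) (evalCompile₁ 0F η n)) ,
    mk⇔ (λ t → let α , r = true⇒realiser (formula P) t in realises⇒true (formula Q) (to α r))
        (λ t → let α , r = true⇒realiser (formula Q) t in realises⇒true (formula P) (from α r)) ,
    (λ α w → _ , evalFill (prefix Q) (evalCompile₁ 0F s₋)
                   (λ n → subst (Eval _ _ _) (eq n) (evalCompile₁ 1F η n)) ,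
             realises⇒witness (formula Q) (to α (witness⇒realises (formula P) w))) ,
    (λ α w → _ , evalFill (prefix P) (evalCompile₁ 0F s₊) (λ n → evalOracle 1F) ,
             realises⇒witness (formula P) (from α (witness⇒realises (formula Q) w)))

-- Deciding bounded formulas

-- The first function lies at the even places, the code of the others at the odd ones. The last
-- function is not interleaved any further, hence the clause for a single function.
position : ∀ {b} → Fin b → ℕ → ℕ
position {suc zero}    zero    j = j
position {suc (suc b)} zero    j = j + j
position {suc (suc b)} (suc f) j = suc (position f j + position f j)

codeFunctions-position : ∀ {b} (fs : Vec Baire b) f j → codeFunctions fs (position f j) ≡ lookup fs f j
codeFunctions-position (g ∷ [])         zero    j = refl
codeFunctions-position (g ∷ fs@(_ ∷ _)) zero    j = ⊕-even g (codeFunctions fs) j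
codeFunctions-position (g ∷ fs@(_ ∷ _)) (suc f) j =
  trans (⊕-odd g (codeFunctions fs) (position f j)) (codeFunctions-position fs f j)

code-function : ∀ {a b} (ns : Vec ℕ a) (fs : Vec Baire b) f j →
                code (ns , fs) (a + position f j) ≡ lookup fs f j
code-function []       fs f j = codeFunctions-position fs f j
code-function (n ∷ ns) fs f j = code-function ns fs f j

code-number : ∀ {a b} (ns : Vec ℕ a) (fs : Vec Baire b) i → code (ns , fs) (toℕ i) ≡ lookup ns i
code-number (n ∷ ns) fs zero    = refl
code-number (n ∷ ns) fs (suc i) = code-number ns fs i

positionᵉ : ∀ {b n} → Fin b → Exp 1 n → Exp 1 n
positionᵉ {suc zero}    zero    e = e
positionᵉ {suc (suc b)} zero    e = app₂ addᶜ e e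
positionᵉ {suc (suc b)} (suc f) e = app₁ sucᶜ (app₂ addᶜ (positionᵉ f e) (positionᵉ f e))

⟦positionᵉ⟧ : ∀ {b n} (f : Fin b) (e : Exp 1 n) αs xs →
              ⟦ positionᵉ f e ⟧ₑ αs xs ≡ position f (⟦ e ⟧ₑ αs xs)
⟦positionᵉ⟧ {suc zero}    zero    e αs xs = refl
⟦positionᵉ⟧ {suc (suc b)} zero    e αs xs = refl
⟦positionᵉ⟧ {suc (suc b)} (suc f) e αs xs =
  cong₂ (λ p q → suc (p + q)) (⟦positionᵉ⟧ f e αs xs) (⟦positionᵉ⟧ f e αs xs)

-- The oracle holds the instance, whose functions start at index a.
termᵉ : ∀ {b n} → ℕ → Term b n → Exp 1 n
termᵉ a (var i)   = arg i
termᵉ a 0̇         = lit 0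
termᵉ a (Ṡ t)     = app₁ sucᶜ (termᵉ a t)
termᵉ a (t +̇ u)   = app₂ addᶜ (termᵉ a t) (termᵉ a u)
termᵉ a (t *̇ u)   = app₂ mulᶜ (termᵉ a t) (termᵉ a u)
termᵉ a (t ∸̇ u)   = app₂ monusᶜ (termᵉ a t) (termᵉ a u)
termᵉ a ⟪ t , u ⟫ = app₂ pairᶜ (termᵉ a t) (termᵉ a u)
termᵉ a (len t)   = app₁ sizeᶜ (termᵉ a t)
termᵉ a (t ! u)   = app₂ entᶜ (termᵉ a t) (termᵉ a u)
termᵉ a (f · t)   = ask 0F (app₂ addᶜ (lit a) (positionᵉ f (termᵉ a t)))

-- Evaluates to 0 exactly when the formula holds.
boundedᵉ : ∀ {b n} → ℕ → Bounded b n → Exp 1 n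
boundedᵉ a (t ≐ u)    = app₂ distᶜ (termᵉ a t) (termᵉ a u)
boundedᵉ a (t ≤̇ u)    = app₂ monusᶜ (termᵉ a t) (termᵉ a u)
boundedᵉ a (¬̇ θ)      = app₂ monusᶜ (lit 1) (boundedᵉ a θ)
boundedᵉ a (θ ∧̇ ρ)    = app₂ addᶜ (boundedᵉ a θ) (boundedᵉ a ρ)
boundedᵉ a (θ ∨̇ ρ)    = app₂ mulᶜ (boundedᵉ a θ) (boundedᵉ a ρ)
boundedᵉ a (θ ⇒̇ ρ)    = app₂ mulᶜ (app₂ monusᶜ (lit 1) (boundedᵉ a θ)) (boundedᵉ a ρ)
boundedᵉ a (∀< t ∙ θ) =
  rec (lit 0) (app₂ addᶜ (call (boundedᵉ a θ) (arg 0F ∷ tabulate (arg ∘ under₂))) (arg 1F)) (termᵉ a t)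
boundedᵉ a (∃< t ∙ θ) =
  rec (lit 1) (app₂ mulᶜ (call (boundedᵉ a θ) (arg 0F ∷ tabulate (arg ∘ under₂))) (arg 1F)) (termᵉ a t)

≡0? : ∀ n → n ≡ 0 ⊎ 1 ∸ n ≡ 0
≡0? zero    = inj₁ refl
≡0? (suc n) = inj₂ (0∸n≡0 n)

¬-≡0 : ∀ n → (1 ∸ n ≡ 0) ⇔ (¬ n ≡ 0)
¬-≡0 zero    = mk⇔ (λ ()) (λ n≢0 → contradiction refl n≢0)
¬-≡0 (suc n) = mk⇔ (λ _ ()) (λ _ → 0∸n≡0 n)

module _ (f : ℕ → ℕ) where

  -- With `0` as truth, a bounded universal quantifier is a sum and a bounded existential one a
  -- product.
  sum-≡0 : ∀ n → (natrec 0 (λ i y → f i + y) n ≡ 0) ⇔ (∀ i → i < n → f i ≡ 0)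
  sum-≡0 n = mk⇔ (to n) (from n)
    where
    to : ∀ n → natrec 0 (λ i y → f i + y) n ≡ 0 → ∀ i → i < n → f i ≡ 0
    to (suc n) eq i (s≤s i≤n) with m≤n⇒m<n∨m≡n i≤n
    ... | inj₁ i<n  = to n (m+n≡0⇒n≡0 (f n) eq) i i<n
    ... | inj₂ refl = m+n≡0⇒m≡0 (f n) eq
    from : ∀ n → (∀ i → i < n → f i ≡ 0) → natrec 0 (λ i y → f i + y) n ≡ 0
    from zero    p = refl
    from (suc n) p = cong₂ _+_ (p n ≤-refl) (from n (λ i i<n → p i (m<n⇒m<1+n i<n)))

  product-≡0 : ∀ n → (natrec 1 (λ i y → f i * y) n ≡ 0) ⇔ (∃[ i ] i < n × f i ≡ 0)
  product-≡0 n = mk⇔ (to n) λ { (i , i<n , eq) → from n i i<n eq }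
    where
    to : ∀ n → natrec 1 (λ i y → f i * y) n ≡ 0 → ∃[ i ] i < n × f i ≡ 0
    to (suc n) eq with m*n≡0⇒m≡0∨n≡0 (f n) eq
    ... | inj₁ fn≡0 = n , ≤-refl , fn≡0
    ... | inj₂ eq′  = let i , i<n , p = to n eq′ in i , m<n⇒m<1+n i<n , p
    from : ∀ n i → i < n → f i ≡ 0 → natrec 1 (λ i y → f i * y) n ≡ 0
    from (suc n) i (s≤s i≤n) eq with m≤n⇒m<n∨m≡n i≤n
    ... | inj₁ i<n  = trans (cong (f n *_) (from n i i<n eq)) (*-zeroʳ (f n))
    ... | inj₂ refl = cong (_* natrec 1 (λ i y → f i * y) n) eq

⟦under₂⟧ : ∀ {k n} (αs : Vec Baire k) i y (xs : Vec ℕ n) →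
           ⟦ tabulate (arg ∘ under₂) ⟧ₑ* αs (i ∷ y ∷ xs) ≡ xs
⟦under₂⟧ αs i y xs = trans (⟦tabulate⟧ (arg ∘ under₂) αs (i ∷ y ∷ xs)) (tabulate∘lookup xs)

open Equivalence

module _ (α : Baire) {b} (fs : Vec Baire b) (a : ℕ)
         (functions : ∀ f j → α (a + position f j) ≡ lookup fs f j) where

  ⟦termᵉ⟧ : ∀ {n} (t : Term b n) xs → ⟦ termᵉ a t ⟧ₑ (α ∷ []) xs ≡ ⟦ t ⟧ₜ (xs , fs)
  ⟦termᵉ⟧ (var i)   xs = refl
  ⟦termᵉ⟧ 0̇         xs = refl
  ⟦termᵉ⟧ (Ṡ t)     xs = cong suc (⟦termᵉ⟧ t xs)
  ⟦termᵉ⟧ (t +̇ u)   xs = cong₂ _+_ (⟦termᵉ⟧ t xs) (⟦termᵉ⟧ u xs)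
  ⟦termᵉ⟧ (t *̇ u)   xs = cong₂ _*_ (⟦termᵉ⟧ t xs) (⟦termᵉ⟧ u xs)
  ⟦termᵉ⟧ (t ∸̇ u)   xs = cong₂ _∸_ (⟦termᵉ⟧ t xs) (⟦termᵉ⟧ u xs)
  ⟦termᵉ⟧ ⟪ t , u ⟫ xs = cong₂ pair (⟦termᵉ⟧ t xs) (⟦termᵉ⟧ u xs)
  ⟦termᵉ⟧ (len t)   xs = cong size (⟦termᵉ⟧ t xs)
  ⟦termᵉ⟧ (t ! u)   xs = cong₂ ent (⟦termᵉ⟧ t xs) (⟦termᵉ⟧ u xs)
  ⟦termᵉ⟧ (f · t)   xs =
    trans (cong (λ j → α (a + j)) (⟦positionᵉ⟧ f (termᵉ a t) (α ∷ []) xs))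
          (trans (functions f _) (cong (lookup fs f) (⟦termᵉ⟧ t xs)))

  boundedᵉ-decides : ∀ {n} (θ : Bounded b n) xs → (⟦ boundedᵉ a θ ⟧ₑ (α ∷ []) xs ≡ 0) ⇔ ⟦ θ ⟧ (xs , fs)
  boundedᵉ-decides (t ≐ u) xs rewrite ⟦termᵉ⟧ t xs | ⟦termᵉ⟧ u xs = mk⇔ ∣m-n∣≡0⇒m≡n m≡n⇒∣m-n∣≡0
  boundedᵉ-decides (t ≤̇ u) xs rewrite ⟦termᵉ⟧ t xs | ⟦termᵉ⟧ u xs = mk⇔ m∸n≡0⇒m≤n m≤n⇒m∸n≡0
  boundedᵉ-decides (¬̇ θ)   xs =
    mk⇔ (λ eq p → to (¬-≡0 _) eq (from (boundedᵉ-decides θ xs) p))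
        (λ ¬p → from (¬-≡0 _) (λ eq → ¬p (to (boundedᵉ-decides θ xs) eq)))
  boundedᵉ-decides (θ ∧̇ ρ) xs =
    mk⇔ (λ eq → to (boundedᵉ-decides θ xs) (m+n≡0⇒m≡0 _ eq) ,
                to (boundedᵉ-decides ρ xs) (m+n≡0⇒n≡0 (⟦ boundedᵉ a θ ⟧ₑ (α ∷ []) xs) eq))
        (λ { (p , q) → cong₂ _+_ (from (boundedᵉ-decides θ xs) p) (from (boundedᵉ-decides ρ xs) q) })
  boundedᵉ-decides (θ ∨̇ ρ) xs = mk⇔ split merge
    where
    split : ⟦ boundedᵉ a (θ ∨̇ ρ) ⟧ₑ (α ∷ []) xs ≡ 0 → ⟦ θ ∨̇ ρ ⟧ (xs , fs)
    split eq with m*n≡0⇒m≡0∨n≡0 (⟦ boundedᵉ a θ ⟧ₑ (α ∷ []) xs) eq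
    ... | inj₁ p = inj₁ (to (boundedᵉ-decides θ xs) p)
    ... | inj₂ q = inj₂ (to (boundedᵉ-decides ρ xs) q)
    merge : ⟦ θ ∨̇ ρ ⟧ (xs , fs) → ⟦ boundedᵉ a (θ ∨̇ ρ) ⟧ₑ (α ∷ []) xs ≡ 0
    merge (inj₁ p) rewrite from (boundedᵉ-decides θ xs) p = refl
    merge (inj₂ q) rewrite from (boundedᵉ-decides ρ xs) q = *-zeroʳ (⟦ boundedᵉ a θ ⟧ₑ (α ∷ []) xs)
  boundedᵉ-decides (θ ⇒̇ ρ) xs = mk⇔ apply discharge
    where
    v = ⟦ boundedᵉ a θ ⟧ₑ (α ∷ []) xs
    apply : ⟦ boundedᵉ a (θ ⇒̇ ρ) ⟧ₑ (α ∷ []) xs ≡ 0 → ⟦ θ ⇒̇ ρ ⟧ (xs , fs)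
    apply eq p with m*n≡0⇒m≡0∨n≡0 (1 ∸ v) eq
    ... | inj₁ v≢0 = contradiction (from (boundedᵉ-decides θ xs) p) (to (¬-≡0 v) v≢0)
    ... | inj₂ q   = to (boundedᵉ-decides ρ xs) q
    discharge : ⟦ θ ⇒̇ ρ ⟧ (xs , fs) → ⟦ boundedᵉ a (θ ⇒̇ ρ) ⟧ₑ (α ∷ []) xs ≡ 0
    -- An implication does not say whether its antecedent holds, but the computed value `v` does.
    discharge imp with ≡0? v
    ... | inj₁ p =
      trans (cong ((1 ∸ v) *_) (from (boundedᵉ-decides ρ xs) (imp (to (boundedᵉ-decides θ xs) p))))
            (*-zeroʳ (1 ∸ v))
    ... | inj₂ q rewrite q = refl
  boundedᵉ-decides (∀< t ∙ θ) xs =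
    mk⇔ (λ eq i i<n → to (boundedᵉ-decides θ (i ∷ xs)) (to (sum-≡0 f bound) (trans (sym loop) eq) i i<n))
        (λ p → trans loop (from (sum-≡0 f bound) (λ i i<n → from (boundedᵉ-decides θ (i ∷ xs)) (p i i<n))))
    where
    f = λ i → ⟦ boundedᵉ a θ ⟧ₑ (α ∷ []) (i ∷ xs)
    bound = ⟦ t ⟧ₜ (xs , fs)
    loop : ⟦ boundedᵉ a (∀< t ∙ θ) ⟧ₑ (α ∷ []) xs ≡ natrec 0 (λ i y → f i + y) bound
    loop = natrec-cong
      (λ i y → cong (λ zs → ⟦ boundedᵉ a θ ⟧ₑ (α ∷ []) (i ∷ zs) + y) (⟦under₂⟧ (α ∷ []) i y xs))
      (⟦termᵉ⟧ t xs)
  boundedᵉ-decides (∃< t ∙ θ) xs =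
    mk⇔ (λ eq → let i , i<n , p = to (product-≡0 f bound) (trans (sym loop) eq) in
                i , i<n , to (boundedᵉ-decides θ (i ∷ xs)) p)
        (λ { (i , i<n , p) →
             trans loop (from (product-≡0 f bound) (i , i<n , from (boundedᵉ-decides θ (i ∷ xs)) p)) })
    where
    f = λ i → ⟦ boundedᵉ a θ ⟧ₑ (α ∷ []) (i ∷ xs)
    bound = ⟦ t ⟧ₜ (xs , fs)
    loop : ⟦ boundedᵉ a (∃< t ∙ θ) ⟧ₑ (α ∷ []) xs ≡ natrec 1 (λ i y → f i * y) bound
    loop = natrec-cong
      (λ i y → cong (λ zs → ⟦ boundedᵉ a θ ⟧ₑ (α ∷ []) (i ∷ zs) * y) (⟦under₂⟧ (α ∷ []) i y xs))
      (⟦termᵉ⟧ t xs)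

-- Tabulated matrices and the complete formula.

numbersᵉ : ∀ a → Vec (Exp 1 1) a
numbersᵉ a = tabulate (λ i → ask 0F (lit (toℕ i)))

⟦numbersᵉ⟧ : ∀ {a b} (ns : Vec ℕ a) (fs : Vec Baire b) xs →
             ⟦ numbersᵉ a ⟧ₑ* (code (ns , fs) ∷ []) xs ≡ ns
⟦numbersᵉ⟧ ns fs xs = trans (⟦tabulate⟧ (λ i → ask 0F (lit (toℕ i))) (code (ns , fs) ∷ []) xs)
                            (trans (tabulate-cong (code-number ns fs)) (tabulate∘lookup ns))

-- The inputs k, m, n of the matrix are read off the index pair (pair n m) k.
tableᵉ : ∀ {b a} → Bounded b (3 + a) → Exp 1 1
tableᵉ {a = a} θ = call (boundedᵉ a θ)
  (app₁ sndᶜ (arg 0F) ∷ app₁ sndᶜ (app₁ fstᶜ (arg 0F)) ∷ app₁ fstᶜ (app₁ fstᶜ (arg 0F)) ∷ numbersᵉ a)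

table-decides : ∀ {b a} (θ : Bounded b (3 + a)) (x : Tuple a b) n m k →
                (run (tableᵉ θ) (code x) (pair (pair n m) k) ≡ 0) ⇔ ⟦ θ ⟧ (k ◂ m ◂ n ◂ x)
table-decides {a = a} θ (ns , fs) n m k
  rewrite fst-pair (pair n m) k | snd-pair (pair n m) k | fst-pair n m | snd-pair n m
        | ⟦numbersᵉ⟧ ns fs (pair (pair n m) k ∷ []) =
  boundedᵉ-decides (code (ns , fs)) fs a (code-function ns fs) θ (k ∷ m ∷ n ∷ ns)

complete : Formula 1 (`∀∞ ∷ `∀ ∷ `∃ ∷ []) 0
complete = quant `∀∞ (quant `∀ (quant `∃ (matrix
  (0F · ⟪ ⟪ var 2F , var 1F ⟫ , var 0F ⟫ ≐ 0̇))))

table : ∀ {b a} → Bounded b (3 + a) → Tuple a b → Tuple 0 1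
table θ x = [] , run (tableᵉ θ) (code x) ∷ []

table-instance : ∀ {b a} (θ : Bounded b (3 + a)) (x : Tuple a b) → All Computable (proj₂ x) →
                 Instance ⌈ complete ⌉ (table θ x)
table-instance θ (ns , fs) cs =
  (computable-image (tableᵉ θ) (computable-code ns cs ∷ []) ∷ []) , unrestricted

-- Both formulas quantify over the same `n`, `m`, `k` and have equivalent matrices there, so
-- realisers pass unchanged in all four directions.
complete-strictlyDicomplete : StrictlyDicomplete (`∀∞ ∷ `∀ ∷ `∃ ∷ []) complete
complete-strictlyDicomplete ψ@(quant `∀∞ (quant `∀ (quant `∃ (matrix θ)))) =
  compile₁ 0F (tableᵉ θ) ,
  reduction {⌈ ψ ⌉} {⌈ complete ⌉} (tableᵉ θ) idᵉ idᵉ (λ x (cs , _) →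
    table θ x , table-instance θ x cs , (λ _ → refl) ,
    (λ α r n p m → from (table-decides θ x n m _) (r n p m)) ,
    (λ α r n p m → to (table-decides θ x n m _) (r n p m))) ,
  reduction {⌈ ψ ⌉ ᵈ} {⌈ complete ⌉ ᵈ} (tableᵉ θ) idᵉ idᵉ (λ x (cs , _) →
    table θ x , table-instance θ x cs , (λ _ → refl) ,
    (λ α r n → proj₁ (r n) , λ k → proj₂ (r n) k ∘ to (table-decides θ x _ _ k)) ,
    (λ α r n → proj₁ (r n) , λ k → proj₂ (r n) k ∘ from (table-decides θ x _ _ k)))
  where
  idᵉ : Exp 1 1
  idᵉ = ask 0F (arg 0F)

-- Reducing finite diameter to the complete formula.

FinDiamMatrix : Bounded 2 3
FinDiamMatrix = isPath 1F ⇒̇ (isPath 0F ∧̇ sameEnds 1F 0F ∧̇ length[ 0F ] ≤̇ var 2F)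

FinDiamMatrix-monotone : ∀ δ γ x {r s} → r ≤ s → ⟦ FinDiamMatrix ⟧ (δ ◂ γ ◂ r ◂ x) →
                         ⟦ FinDiamMatrix ⟧ (δ ◂ γ ◂ s ◂ x)
FinDiamMatrix-monotone δ γ x r≤s imp p = let q , ends , le = imp p in q , ends , ≤-trans le r≤s

FinDiam≤complete : FinDiam-conn ≤dm ⌈ complete ⌉
FinDiam≤complete =
  compile₁ 0F (tableᵉ θ) ,
  reduction {FinDiam-conn} {⌈ complete ⌉} (tableᵉ θ)
    -- The bound `r` becomes the threshold. At `n`, with `γ` in the place of `m`, the path chosen
    -- for `r` is reused, being good for every larger bound.
    (ifzᵉ (arg 0F) (ask 0F (lit 0))
          (ask 0F (app₁ sucᶜ (app₂ pairᶜ (app₁ fstᶜ (app₁ sndᶜ (app₁ predᶜ (arg 0F)))) (lit 0)))))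
    -- The threshold serves as the bound, with the paths that the realiser holds for `n` equal to
    -- it.
    (ifzᵉ (arg 0F) (ask 0F (lit 0))
          (ask 0F (app₁ sucᶜ (app₂ pairᶜ (ask 0F (lit 0)) (app₁ predᶜ (arg 0F))))))
    (λ x (cs , _) →
      table θ x , table-instance θ x cs , (λ _ → refl) ,
      (λ α r n p γ → from (table-decides θ x n γ _)
        (subst (λ γ′ → ⟦ θ ⟧ (α (suc (pair γ′ 0)) ◂ γ ◂ n ◂ x))
          (sym (trans (cong fst (snd-pair n (pair γ 0))) (fst-pair γ 0)))
          (FinDiamMatrix-monotone (α (suc (pair γ 0))) γ x p (r γ)))) ,
      (λ α r γ → to (table-decides θ x _ γ _) (r (α 0) ≤-refl γ))) ,
  reduction {FinDiam-conn ᵈ} {⌈ complete ⌉ ᵈ} (tableᵉ θ)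
    -- For the dual, `n` itself is returned, together with the path whose ends are not joined within
    -- the bound `n`.
    (ifzᵉ (app₁ sndᶜ (arg 0F)) (app₁ fstᶜ (arg 0F))
          (ask 0F (app₂ pairᶜ (app₁ fstᶜ (arg 0F)) (lit 0))))
    -- The path found for some `n` at least `r` is also a counterexample for the smaller bound `r`.
    (ask 0F (app₂ pairᶜ (app₁ fstᶜ (arg 0F)) (lit 1)))
    (λ x (cs , _) →
      table θ x , table-instance θ x cs , (λ _ → refl) ,
      (λ α r n →
        let index  = cong₂ (λ i m → ifz i m (α (pair m 0))) (snd-pair n 0) (fst-pair n 0)
            path   = cong₂ (λ i m → ifz i m (α (pair m 0))) (snd-pair n 1) (fst-pair n 1)
        in ≤-reflexive (sym index) , λ k eq → r n k
             (subst₂ (λ γ m → ⟦ θ ⟧ (k ◂ γ ◂ m ◂ x)) path index (to (table-decides θ x _ _ k) eq))) ,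
      (λ α r n δ p → proj₂ (r n) δ (from (table-decides θ x _ _ δ)
        (FinDiamMatrix-monotone δ (α (pair n 1)) x (proj₁ (r n))
          (subst (λ m → ⟦ θ ⟧ (δ ◂ α (pair m 1) ◂ n ◂ x)) (fst-pair n 0) p)))))
  where
  θ = FinDiamMatrix

-- The graph of a table

-- A vertex pair p s lies in the component of p = pair n m.  The numbers s ≤ n form a
-- spine, and s = n + 1 + k is a hub adjacent to the whole spine, present when x (pair p k) = 0.
excess : ℕ → ℕ
excess v = snd v ∸ fst (fst v)

-- d is the distance of the second coordinates, which matters between spine vertices only.
nonAdjacency : ℕ → ℕ → ℕ → ℕ
nonAdjacency a b d = ifz a (ifz b ∣ d - 1 ∣ 0) (ifz b 0 1)

nonAdjacency-comm : ∀ a b d → nonAdjacency a b d ≡ nonAdjacency b a d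
nonAdjacency-comm zero    zero    d = refl
nonAdjacency-comm zero    (suc b) d = refl
nonAdjacency-comm (suc a) zero    d = refl
nonAdjacency-comm (suc a) (suc b) d = refl

excessᵉ : ∀ {n} → Exp 1 n → Exp 1 n
excessᵉ v = app₂ monusᶜ (app₁ sndᶜ v) (app₁ fstᶜ (app₁ fstᶜ v))

-- The product vanishes on the spine because `excess` does, and at the hub `k`, of excess `suc k`,
-- exactly when `x (pair p k)` does.
nonVertexᵉ : ∀ {n} → Exp 1 n → Exp 1 n
nonVertexᵉ v = app₂ mulᶜ (excessᵉ v) (ask 0F (app₂ pairᶜ (app₁ fstᶜ v) (app₁ predᶜ (excessᵉ v))))

nonEdgeᵉ : ∀ {n} → Exp 1 n → Exp 1 n → Exp 1 n
nonEdgeᵉ u v = app₂ addᶜ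
  (app₂ addᶜ (nonVertexᵉ u) (nonVertexᵉ v))
  (app₂ addᶜ (app₂ distᶜ (app₁ fstᶜ u) (app₁ fstᶜ v))
             (ifzᵉ (excessᵉ u)
               (ifzᵉ (excessᵉ v) (app₂ distᶜ (app₂ distᶜ (app₁ sndᶜ u) (app₁ sndᶜ v)) (lit 1)) (lit 0))
               (ifzᵉ (excessᵉ v) (lit 0) (lit 1))))

verticesᵉ edgesᵉ : Exp 1 1 → Exp 1 1
verticesᵉ e = app₂ monusᶜ (lit 1) (nonVertexᵉ e)
edgesᵉ e    = app₂ monusᶜ (lit 1) (nonEdgeᵉ (app₁ fstᶜ e) (app₁ sndᶜ e))

graphᵉ : Exp 1 1
graphᵉ = ifzᵉ (app₁ parityᶜ (arg 0F)) (verticesᵉ (app₁ halfᶜ (arg 0F))) (edgesᵉ (app₁ halfᶜ (arg 0F)))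

1∸n≡1 : ∀ {n} → (1 ∸ n ≡ 1) ⇔ (n ≡ 0)
1∸n≡1 {zero}  = mk⇔ (λ _ → refl) (λ _ → refl)
1∸n≡1 {suc n} = mk⇔ (λ eq → contradiction (trans (sym (0∸n≡0 n)) eq) (λ ())) (λ ())

-- Spines, hubs and detours as numbers.

start end : List ℕ → ℕ
start l = entry l 0
end l   = entry l (length l ∸ 1)

SameEnds : List ℕ → List ℕ → Set
SameEnds l l′ = (start l ≡ start l′ × end l ≡ end l′) ⊎ (start l ≡ end l′ × end l ≡ start l′)

-- `cons` prepends, so the spine is listed downwards: it starts at `pair p (fst p)` and ends at
-- `pair p 0`.
spineUpto : ℕ → ℕ → ℕ
spineUpto p = natrec (cons (pair p 0) 0) (λ j c → cons (pair p (suc j)) c)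

spine : ℕ → ℕ
spine p = spineUpto p (fst p)

spineᶜ : Programmable (uncurry₁ spine)
spineᶜ = programmable
  (rec (app₂ consᶜ (app₂ pairᶜ (arg 0F) (lit 0)) (lit 0))
       (app₂ consᶜ (app₂ pairᶜ (arg 2F) (app₁ sucᶜ (arg 0F))) (arg 1F))
       (app₁ fstᶜ (arg 0F)))
  λ { (p ∷ []) → refl }

spineUpto-length : ∀ p j → size (spineUpto p j) ≡ suc j
spineUpto-length p zero    = cong length (decode-cons (pair p 0) 0)
spineUpto-length p (suc j) = trans (cong length (decode-cons (pair p (suc j)) (spineUpto p j)))
                                   (cong suc (spineUpto-length p j))

spineUpto-entry : ∀ p j i → i ≤ j → ent (spineUpto p j) i ≡ pair p (j ∸ i)
spineUpto-entry p zero    zero    _       = cong start (decode-cons (pair p 0) 0)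
spineUpto-entry p (suc j) zero    _       = cong start (decode-cons (pair p (suc j)) (spineUpto p j))
spineUpto-entry p (suc j) (suc i) (s≤s q) =
  trans (cong (λ l → entry l (suc i)) (decode-cons (pair p (suc j)) (spineUpto p j)))
        (spineUpto-entry p j i q)

-- 1 + k if the path γ passes through a hub k, and 0 if it avoids all hubs.
lastHubWithin : ℕ → ℕ → ℕ
lastHubWithin γ = natrec 0 (λ i y → ifz (excess (ent γ i)) y (excess (ent γ i)))

lastHub : ℕ → ℕ
lastHub γ = lastHubWithin γ (size γ)

lastHubᶜ : Programmable (uncurry₁ lastHub)
lastHubᶜ = programmable
  (rec (lit 0) (ifzᵉ excessOfEntry (arg 1F) excessOfEntry) (app₁ sizeᶜ (arg 0F)))
  λ { (γ ∷ []) → refl }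
  where
  entryᵉ        = app₂ entᶜ (arg 2F) (arg 0F)
  excessOfEntry = app₂ monusᶜ (app₁ sndᶜ entryᵉ) (app₁ fstᶜ (app₁ fstᶜ entryᵉ))

Avoids Meets : ℕ → ℕ → Set
Avoids γ n = lastHubWithin γ n ≡ 0 × (∀ i → i < n → excess (ent γ i) ≡ 0)
Meets  γ n = ∃[ i ] i < n × ∃[ k ] lastHubWithin γ n ≡ suc k × excess (ent γ i) ≡ suc k

-- The scan overwrites its value at each hub and keeps it at spine vertices. A nonzero outcome is
-- thus the excess of a hub on the path.
avoids-or-meets : ∀ γ n → Avoids γ n ⊎ Meets γ n
avoids-or-meets γ zero    = inj₁ (refl , λ _ ())
avoids-or-meets γ (suc n) = step (excess (ent γ n)) refl (avoids-or-meets γ n)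
  where
  step : ∀ e → excess (ent γ n) ≡ e → Avoids γ n ⊎ Meets γ n → Avoids γ (suc n) ⊎ Meets γ (suc n)
  step zero    eq (inj₁ (h , avoids)) = inj₁ (trans last h , spineVertex)
    where
    last = cong (λ e → ifz e (lastHubWithin γ n) e) eq
    spineVertex : ∀ i → i < suc n → excess (ent γ i) ≡ 0
    spineVertex i (s≤s i≤n) with m≤n⇒m<n∨m≡n i≤n
    ... | inj₁ i<n  = avoids i i<n
    ... | inj₂ refl = eq
  step zero    eq (inj₂ (i , i<n , k , h , hub)) =
    inj₂ (i , m<n⇒m<1+n i<n , k , trans (cong (λ e → ifz e (lastHubWithin γ n) e) eq) h , hub)
  step (suc k) eq _ = inj₂ (n , ≤-refl , k , cong (λ e → ifz e (lastHubWithin γ n) e) eq , eq)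

hub : ℕ → ℕ → ℕ
hub p k = pair p (suc (fst p + k))

excess-hub : ∀ p k → excess (hub p k) ≡ suc k
excess-hub p k rewrite fst-pair p (suc (fst p + k)) | snd-pair p (suc (fst p + k)) | sym (+-suc (fst p) k) =
  m+n∸m≡n (fst p) (suc k)

excess-spine : ∀ p s → s ≤ fst p → excess (pair p s) ≡ 0
excess-spine p s s≤n rewrite fst-pair p s | snd-pair p s = m≤n⇒m∸n≡0 s≤n

-- From a to b in at most two steps, in a component with the hub k.
shortcutBy : ℕ → ℕ → ℕ → ℕ → ℕ → ℕ
shortcutBy ea eb a b k =
  ifz ea (ifz eb (cons a (cons (hub (fst a) k) (cons b 0))) (cons a (cons b 0)))
         (ifz eb (cons a (cons b 0)) (cons a (cons (pair (fst a) 0) (cons b 0))))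

-- A path within the bound is its own detour. For a longer one, a hub that it meets is preferred to
-- the proposed `k`, which is guaranteed to be a hub only if the spine is long.
detour : ℕ → ℕ → ℕ → ℕ
detour r γ k =
  ifz (size γ ∸ 1 ∸ r) γ
    (shortcutBy (excess a) (excess b) a b (ifz (lastHub γ) k (pred (lastHub γ))))
  where
  a = start (decode γ)
  b = end (decode γ)

detourᵉ : Exp 1 1 → Exp 1 1 → Exp 1 1 → Exp 1 1
detourᵉ r γ k =
  ifzᵉ (app₂ monusᶜ length-1 r) γ
    (ifzᵉ (excessᵉ a) (ifzᵉ (excessᵉ b) via-hub direct) (ifzᵉ (excessᵉ b) direct via-spine))
  where
  length-1 = app₂ monusᶜ (app₁ sizeᶜ γ) (lit 1)
  a = app₂ entᶜ γ (lit 0)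
  b = app₂ entᶜ γ length-1
  k′ = ifzᵉ (app₁ lastHubᶜ γ) k (app₁ predᶜ (app₁ lastHubᶜ γ))
  direct = app₂ consᶜ a (app₂ consᶜ b (lit 0))
  through : Exp 1 1 → Exp 1 1
  through v = app₂ consᶜ a (app₂ consᶜ v (app₂ consᶜ b (lit 0)))
  via-hub = through (app₂ pairᶜ (app₁ fstᶜ a) (app₁ sucᶜ (app₂ addᶜ (app₁ fstᶜ (app₁ fstᶜ a)) k′)))
  via-spine = through (app₂ pairᶜ (app₁ fstᶜ a) (lit 0))

-- Vertices and edges of the graph.

module Graph (x : Baire) where

  χV χE : Baire
  χV = run (verticesᵉ (arg 0F)) x
  χE = run (edgesᵉ (arg 0F)) x

  nonVertex : ℕ → ℕ
  nonVertex v = excess v * x (pair (fst v) (pred (excess v)))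

  record Vertex (v : ℕ) : Set where
    constructor vertex
    field nonVertex≡0 : nonVertex v ≡ 0

  open Vertex

  nonVertex-by : ∀ v {e} → excess v ≡ e → nonVertex v ≡ e * x (pair (fst v) (pred e))
  nonVertex-by v = cong (λ e → e * x (pair (fst v) (pred e)))

  spine-vertex : ∀ {v} → excess v ≡ 0 → Vertex v
  spine-vertex {v} eq = vertex (nonVertex-by v eq)

  hub-vertex : ∀ {v k} → excess v ≡ suc k → x (pair (fst v) k) ≡ 0 → Vertex v
  hub-vertex {v} {k} eq x≡0 =
    vertex (trans (nonVertex-by v eq) (trans (cong (suc k *_) x≡0) (*-zeroʳ (suc k))))

  vertex-hub : ∀ {v k} → excess v ≡ suc k → Vertex v → x (pair (fst v) k) ≡ 0
  vertex-hub {v} {k} eq (vertex p) = m+n≡0⇒m≡0 _ (trans (sym (nonVertex-by v eq)) p)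

  nonEdge : ℕ → ℕ → ℕ
  nonEdge u v = (nonVertex u + nonVertex v) +
                (∣ fst u - fst v ∣ + nonAdjacency (excess u) (excess v) ∣ snd u - snd v ∣)

  record Edge (u v : ℕ) : Set where
    field
      source        : Vertex u
      target        : Vertex v
      sameComponent : fst u ≡ fst v
      adjacent      : nonAdjacency (excess u) (excess v) ∣ snd u - snd v ∣ ≡ 0

  open Edge

  Edge-sym : ∀ {u v} → Edge u v → Edge v u
  Edge-sym {u} {v} e = record
    { source        = target e
    ; target        = source e
    ; sameComponent = sym (sameComponent e)
    ; adjacent      = trans (cong (nonAdjacency (excess v) (excess u)) (∣-∣-comm (snd v) (snd u)))
                        (trans (nonAdjacency-comm (excess v) (excess u) ∣ snd u - snd v ∣) (adjacent e))
    }

  Edge-irrefl : ∀ {u v} → Edge u v → u ≢ v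
  Edge-irrefl {u} e refl = loopless (excess u)
    (trans (cong (nonAdjacency (excess u) (excess u)) (sym (∣n-n∣≡0 (snd u)))) (adjacent e))
    where
    loopless : ∀ a → nonAdjacency a a 0 ≢ 0
    loopless zero    ()
    loopless (suc a) ()

  hub-edge : ∀ {u v k} → Vertex u → Vertex v → fst u ≡ fst v → excess u ≡ 0 → excess v ≡ suc k → Edge u v
  hub-edge {u} {v} p q same eu ev = record
    { source = p ; target = q ; sameComponent = same
    ; adjacent = cong₂ (λ a b → nonAdjacency a b ∣ snd u - snd v ∣) eu ev }

  spine-step : ∀ {u v} → Edge u v → excess u ≡ 0 → excess v ≡ 0 → ∣ snd u - snd v ∣ ≡ 1
  spine-step {u} {v} e eu ev =
    ∣m-n∣≡0⇒m≡n (trans (sym (cong₂ (λ a b → nonAdjacency a b ∣ snd u - snd v ∣) eu ev)) (adjacent e))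

  χV≡1 : ∀ v → (χV v ≡ 1) ⇔ Vertex v
  χV≡1 v = mk⇔ (λ eq → vertex (to 1∸n≡1 eq)) (λ p → from 1∸n≡1 (nonVertex≡0 p))

  χE≡1 : ∀ u v → (χE (pair u v) ≡ 1) ⇔ Edge u v
  χE≡1 u v = mk⇔ forth back
    where
    unpaired : χE (pair u v) ≡ 1 ∸ nonEdge u v
    unpaired = cong₂ (λ u v → 1 ∸ nonEdge u v) (fst-pair u v) (snd-pair u v)
    forth : χE (pair u v) ≡ 1 → Edge u v
    forth eq = record
      { source        = vertex (m+n≡0⇒m≡0 (nonVertex u) vertices)
      ; target        = vertex (m+n≡0⇒n≡0 (nonVertex u) vertices)
      ; sameComponent = ∣m-n∣≡0⇒m≡n (m+n≡0⇒m≡0 ∣ fst u - fst v ∣ places)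
      ; adjacent      = m+n≡0⇒n≡0 ∣ fst u - fst v ∣ places
      }
      where
      total    = to 1∸n≡1 (trans (sym unpaired) eq)
      vertices = m+n≡0⇒m≡0 (nonVertex u + nonVertex v) total
      places   = m+n≡0⇒n≡0 (nonVertex u + nonVertex v) total
    back : Edge u v → χE (pair u v) ≡ 1
    back e = trans unpaired (from 1∸n≡1
      (cong₂ _+_ (cong₂ _+_ (nonVertex≡0 (source e)) (nonVertex≡0 (target e)))
                 (cong₂ _+_ (m≡n⇒∣m-n∣≡0 (sameComponent e)) (adjacent e))))

  isGraph : IsGraph χV χE
  isGraph = record
    { V-characteristic = λ u → m∸n≤m 1 (nonVertex u)
    ; E-characteristic = λ c → m∸n≤m 1 (nonEdge (fst c) (snd c))
    ; E⊆V²             = λ u v eq → let e = to (χE≡1 u v) eq in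
                           from (χV≡1 u) (source e) , from (χV≡1 v) (target e)
    ; E-symmetric      = λ u v eq → from (χE≡1 v u) (Edge-sym (to (χE≡1 u v) eq))
    }

  -- Paths of the graph.

  record Path (l : List ℕ) : Set where
    field
      nonempty : 1 ≤ length l
      vertices : ∀ i → i < length l → Vertex (entry l i)
      edges    : ∀ i → i < length l ∸ 1 → Edge (entry l i) (entry l (suc i))
      distinct : ∀ i → i < length l → ∀ j → j < i → entry l j ≢ entry l i

    last< : length l ∸ 1 < length l
    last< = ≤-reflexive (m+[n∸m]≡n nonempty)

    before-last : ∀ i → suc i < length l → i < length l ∸ 1
    before-last i p = s≤s⁻¹ (subst (suc i <_) (sym (m+[n∸m]≡n nonempty)) p)

    component : ∀ i → i < length l → fst (entry l i) ≡ fst (start l)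
    component zero    p = refl
    component (suc i) p =
      trans (sym (sameComponent (edges i (before-last i p)))) (component i (<-trans (n<1+n i) p))

    module _ (spine-only : ∀ i → i < length l → excess (entry l i) ≡ 0) where

      -- Each step along the spine changes the coordinate by one. Hence a path that joins the ends
      -- of a spine without a hub has at least as many edges as the spine.
      spine-distance : ∀ i → i < length l → ∣ snd (start l) - snd (entry l i) ∣ ≤ i
      spine-distance zero    p = ≤-reflexive (∣n-n∣≡0 (snd (start l)))
      spine-distance (suc i) p = begin
        ∣ s 0 - s (suc i) ∣                ≤⟨ ∣-∣-triangle (s 0) (s i) (s (suc i)) ⟩
        ∣ s 0 - s i ∣ + ∣ s i - s (suc i) ∣ ≤⟨ +-mono-≤ (spine-distance i i<) (≤-reflexive step) ⟩
        i + 1                             ≡⟨ +-comm i 1 ⟩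
        suc i                             ∎
        where
        open ≤-Reasoning
        s  = snd ∘ entry l
        i< = <-trans (n<1+n i) p
        step : ∣ s i - s (suc i) ∣ ≡ 1
        step = spine-step (edges i (before-last i p)) (spine-only i i<) (spine-only (suc i) p)

      -- Pigeonhole: the vertices are distinct and in one component, so their coordinates are
      -- distinct numbers up to `n`. Hence a long path without hubs forces a large `n`.
      spine-bound : length l ≤ suc (fst (fst (start l)))
      spine-bound = injective⇒≤ {f = coordinate} coordinate-injective
        where
        coordinate< : ∀ (i : Fin (length l)) → snd (entry l (toℕ i)) < suc (fst (fst (start l)))
        coordinate< i = s≤s (subst (λ p → snd (entry l (toℕ i)) ≤ fst p) (component (toℕ i) (toℕ<n i))
                                   (m∸n≡0⇒m≤n (spine-only (toℕ i) (toℕ<n i))))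
        coordinate : Fin (length l) → Fin (suc (fst (fst (start l))))
        coordinate i = fromℕ< (coordinate< i)
        coordinate-injective : ∀ {i j} → coordinate i ≡ coordinate j → i ≡ j
        coordinate-injective {i} {j} eq = toℕ-injective (equal (<-cmp (toℕ i) (toℕ j)))
          where
          same-snd : snd (entry l (toℕ i)) ≡ snd (entry l (toℕ j))
          same-snd = trans (sym (toℕ-fromℕ< (coordinate< i)))
                           (trans (cong toℕ eq) (toℕ-fromℕ< (coordinate< j)))
          same : entry l (toℕ i) ≡ entry l (toℕ j)
          same = pair-injective
            (trans (component (toℕ i) (toℕ<n i)) (sym (component (toℕ j) (toℕ<n j)))) same-snd
          equal : Tri (toℕ i < toℕ j) (toℕ i ≡ toℕ j) (toℕ j < toℕ i) → toℕ i ≡ toℕ j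
          equal (tri< i<j _ _) = contradiction same (distinct (toℕ j) (toℕ<n j) (toℕ i) i<j)
          equal (tri≈ _ i≡j _) = i≡j
          equal (tri> _ _ j<i) = contradiction (sym same) (distinct (toℕ i) (toℕ<n i) (toℕ j) j<i)

  open Path

  path-code : ∀ {n} (γ : Fin n) ns → ⟦ isPath γ ⟧ (ns , χV ∷ χE ∷ []) ⇔ Path (decode (lookup ns γ))
  path-code γ ns = mk⇔
    (λ { (p , q , r , s) → record
      { nonempty = p
      ; vertices = λ i i< → to (χV≡1 (at i)) (q i i<)
      ; edges    = λ i i< → to (χE≡1 (at i) (at (suc i))) (r i i<)
      ; distinct = s } })
    (λ P → nonempty P , (λ i i< → from (χV≡1 (at i)) (vertices P i i<)) ,
           (λ i i< → from (χE≡1 (at i) (at (suc i))) (edges P i i<)) , distinct P)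
    where at = ent (lookup ns γ)

  -- Shortcuts of at most two edges.

  path₂ : ∀ {a b} → Edge a b → Path (a ∷ b ∷ [])
  path₂ e = record
    { nonempty = s≤s z≤n
    ; vertices = λ { 0 _ → source e ; 1 _ → target e ; (suc (suc _)) (s≤s (s≤s ())) }
    ; edges    = λ { 0 _ → e ; (suc _) (s≤s ()) }
    ; distinct = λ { 0 _ _ () ; 1 _ 0 _ → Edge-irrefl e ; 1 _ (suc _) (s≤s ())
                   ; (suc (suc _)) (s≤s (s≤s ())) }
    }

  path₃ : ∀ {a m b} → Edge a m → Edge m b → a ≢ b → Path (a ∷ m ∷ b ∷ [])
  path₃ e f a≢b = record
    { nonempty = s≤s z≤n
    ; vertices = λ { 0 _ → source e ; 1 _ → target e ; 2 _ → target f
                   ; (suc (suc (suc _))) (s≤s (s≤s (s≤s ()))) }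
    ; edges    = λ { 0 _ → e ; 1 _ → f ; (suc (suc _)) (s≤s (s≤s ())) }
    ; distinct = λ { 0 _ _ () ; 1 _ 0 _ → Edge-irrefl e ; 1 _ (suc _) (s≤s ())
                   ; 2 _ 0 _ → a≢b ; 2 _ 1 _ → Edge-irrefl f ; 2 _ (suc (suc _)) (s≤s (s≤s ()))
                   ; (suc (suc (suc _))) (s≤s (s≤s (s≤s ()))) }
    }

  record Connects (a b : ℕ) (l : List ℕ) : Set where
    field
      path   : Path l
      starts : a ≡ start l
      ends   : b ≡ end l
      short  : length l ∸ 1 ≤ 2

  connects₂ : ∀ {a b} → Edge a b → Connects a b (decode (cons a (cons b 0)))
  connects₂ {a} {b} e = subst (Connects a b) (sym decoded) record
    { path = path₂ e ; starts = refl ; ends = refl ; short = s≤s z≤n }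
    where
    decoded = trans (decode-cons a (cons b 0)) (cong (a ∷_) (decode-cons b 0))

  connects₃ : ∀ {a m b} → Edge a m → Edge m b → a ≢ b → Connects a b (decode (cons a (cons m (cons b 0))))
  connects₃ {a} {m} {b} e f a≢b = subst (Connects a b) (sym decoded) record
    { path = path₃ e f a≢b ; starts = refl ; ends = refl ; short = s≤s (s≤s z≤n) }
    where
    decoded = trans (decode-cons a (cons m (cons b 0)))
      (cong (a ∷_) (trans (decode-cons m (cons b 0)) (cong (m ∷_) (decode-cons b 0))))

  -- Two spine vertices are joined through the hub `k`, two hubs through the spine vertex `0` that
  -- every component has, and a hub is adjacent to every spine vertex.
  shortcut-connects : ∀ {a b k} → Vertex a → Vertex b → fst a ≡ fst b → a ≢ b → x (pair (fst a) k) ≡ 0 →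
                      Connects a b (decode (shortcutBy (excess a) (excess b) a b k))
  shortcut-connects {a} {b} {k} Va Vb same a≢b x≡0 = by (excess a) (excess b) refl refl
    where
    h = hub (fst a) k
    z = pair (fst a) 0
    fst-h = fst-pair (fst a) (suc (fst (fst a) + k))
    fst-z = fst-pair (fst a) 0
    excess-z = excess-spine (fst a) 0 z≤n
    Vh : Vertex h
    Vh = hub-vertex (excess-hub (fst a) k) (trans (cong (λ p → x (pair p k)) fst-h) x≡0)
    to-h : ∀ {v} → Vertex v → excess v ≡ 0 → fst v ≡ fst a → Edge v h
    to-h V ev eq = hub-edge V Vh (trans eq (sym fst-h)) ev (excess-hub (fst a) k)
    from-z : ∀ {v e} → Vertex v → excess v ≡ suc e → fst v ≡ fst a → Edge z v
    from-z V ev eq = hub-edge (spine-vertex excess-z) V (trans fst-z (sym eq)) excess-z ev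
    by : ∀ ea eb → excess a ≡ ea → excess b ≡ eb → Connects a b (decode (shortcutBy ea eb a b k))
    by zero    zero    p q = connects₃ (to-h Va p refl) (Edge-sym (to-h Vb q (sym same))) a≢b
    by zero    (suc _) p q = connects₂ (hub-edge Va Vb same p q)
    by (suc _) zero    p q = connects₂ (Edge-sym (hub-edge Vb Va (sym same) q p))
    by (suc _) (suc _) p q = connects₃ (Edge-sym (from-z Va p refl)) (from-z Vb q (sym same)) a≢b

  Short : ℕ → ℕ → ℕ → Set
  Short r γ δ = Path (decode γ) →
                Path (decode δ) × SameEnds (decode γ) (decode δ) × size δ ∸ 1 ≤ r

  short-code : ∀ r γ δ → ⟦ FinDiamMatrix ⟧ (δ ∷ γ ∷ r ∷ [] , χV ∷ χE ∷ []) ⇔ Short r γ δ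
  short-code r γ δ = mk⇔ forth back
    where
    ns = δ ∷ γ ∷ r ∷ []
    forth : ⟦ FinDiamMatrix ⟧ (ns , χV ∷ χE ∷ []) → Short r γ δ
    forth imp P = let q = imp (from (path-code 1F ns) P) in to (path-code 0F ns) (proj₁ q) , proj₂ q
    back : Short r γ δ → ⟦ FinDiamMatrix ⟧ (ns , χV ∷ χE ∷ [])
    back imp p = let Q = imp (to (path-code 1F ns) p) in from (path-code 0F ns) (proj₁ Q) , proj₂ Q

  -- A path stays in its component, and a hub is a vertex only where `x` vanishes.
  meets⇒x≡0 : ∀ {γ k} (P : Path (decode γ)) →
              ((i , _) : ∃[ i ] i < size γ × excess (ent γ i) ≡ suc k) →
              x (pair (fst (start (decode γ))) k) ≡ 0
  meets⇒x≡0 {k = k} P (i , i< , eq) =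
    subst (λ p → x (pair p k) ≡ 0) (component P i i<) (vertex-hub eq (vertices P i i<))

  -- The assumption on `k` is an implication to fit two uses: a realiser of `complete` supplies it,
  -- and a path without short detours refutes it. It settles the case of a path that avoids all
  -- hubs.
  detour-short : ∀ t γ k →
    (t ≤ fst (fst (start (decode γ))) → x (pair (fst (start (decode γ))) k) ≡ 0) →
    Short (2 + t) γ (detour (2 + t) γ k)
  detour-short t γ k hyp P = by (size γ ∸ 1 ∸ (2 + t)) refl
    where
    a = start (decode γ)
    b = end (decode γ)
    k′ = ifz (lastHub γ) k (pred (lastHub γ))
    by : ∀ e → size γ ∸ 1 ∸ (2 + t) ≡ e →
         let δ = ifz e γ (shortcutBy (excess a) (excess b) a b k′) in
         Path (decode δ) × SameEnds (decode γ) (decode δ) × size δ ∸ 1 ≤ 2 + t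
    by zero    eq = P , inj₁ (refl , refl) , m∸n≡0⇒m≤n eq
    by (suc e) eq = path , inj₁ (starts , ends) , ≤-trans short (s≤s (s≤s z≤n))
      where
      long : 2 + t < size γ ∸ 1
      long = ≰⇒> λ le → contradiction (trans (sym eq) (m≤n⇒m∸n≡0 le)) (λ ())
      hub-present : x (pair (fst a) k′) ≡ 0
      hub-present with avoids-or-meets γ (size γ)
      ... | inj₁ (none , avoids) =
        subst (λ h → x (pair (fst a) (ifz h k (pred h))) ≡ 0) (sym none)
          -- A path without hubs has at most `n + 1` vertices, so `2 + t` is below `n`.
          (hyp (≤-trans (m≤n+m t 2) (≤-trans (<⇒≤ long) (∸-monoˡ-≤ 1 (spine-bound P avoids)))))
      ... | inj₂ (i , i< , k″ , found , eq′) =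
        subst (λ h → x (pair (fst a) (ifz h k (pred h))) ≡ 0) (sym found)
          (meets⇒x≡0 {γ} P (i , i< , eq′))
      open Connects (shortcut-connects {k = k′}
        (vertices P 0 (nonempty P)) (vertices P (size γ ∸ 1) (last< P))
        (sym (component P (size γ ∸ 1) (last< P)))
        -- With more than `2 + t` edges the path has two different ends, as a shortcut on three
        -- vertices requires.
        (distinct P (size γ ∸ 1) (last< P) 0 (≤-<-trans z≤n long)) hub-present)

  -- Spines and the paths joining their ends.

  spine-path : ∀ p → Path (decode (spine p))
  spine-path p = record
    { nonempty = subst (1 ≤_) (sym (spineUpto-length p n)) (s≤s z≤n)
    ; vertices = λ i i< → on-spine i (s≤s⁻¹ (subst (i <_) (spineUpto-length p n) i<))
    ; edges    = λ i i< → let i<n = subst (i <_) (cong (_∸ 1) (spineUpto-length p n)) i< in step i i<n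
    ; distinct = λ i i< j j<i → let i≤n = s≤s⁻¹ (subst (i <_) (spineUpto-length p n) i<) in
        λ eq → <⇒≢ j<i (∸-cancelˡ-≡ (≤-trans (<⇒≤ j<i) i≤n) i≤n
          (trans (sym (coordinate j (≤-trans (<⇒≤ j<i) i≤n))) (trans (cong snd eq) (coordinate i i≤n))))
    }
    where
    n = fst p
    coordinate : ∀ i → i ≤ n → snd (ent (spine p) i) ≡ n ∸ i
    coordinate i i≤n = trans (cong snd (spineUpto-entry p n i i≤n)) (snd-pair p (n ∸ i))
    excess≡0 : ∀ i → i ≤ n → excess (ent (spine p) i) ≡ 0
    excess≡0 i i≤n = trans (cong excess (spineUpto-entry p n i i≤n)) (excess-spine p (n ∸ i) (m∸n≤m n i))
    on-spine : ∀ i → i ≤ n → Vertex (ent (spine p) i)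
    on-spine i i≤n = spine-vertex (excess≡0 i i≤n)
    place : ∀ i → i ≤ n → fst (ent (spine p) i) ≡ p
    place i i≤n = trans (cong fst (spineUpto-entry p n i i≤n)) (fst-pair p (n ∸ i))
    step : ∀ i → i < n → Edge (ent (spine p) i) (ent (spine p) (suc i))
    step i i<n = record
      { source        = on-spine i (<⇒≤ i<n)
      ; target        = on-spine (suc i) i<n
      ; sameComponent = trans (place i (<⇒≤ i<n)) (sym (place (suc i) i<n))
      ; adjacent      = trans (cong₂ (λ a b → nonAdjacency a b ∣ s i - s (suc i) ∣)
                                     (excess≡0 i (<⇒≤ i<n)) (excess≡0 (suc i) i<n))
                              (m≡n⇒∣m-n∣≡0 apart)
      }
      where
      s = snd ∘ ent (spine p)
      apart : ∣ s i - s (suc i) ∣ ≡ 1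
      apart = begin
        ∣ s i - s (suc i) ∣                 ≡⟨ cong₂ ∣_-_∣ (coordinate i (<⇒≤ i<n)) (coordinate (suc i) i<n) ⟩
        ∣ n ∸ i - (n ∸ suc i) ∣             ≡⟨ cong (λ m → ∣ m - (n ∸ suc i) ∣) (+-∸-assoc 1 i<n) ⟩
        ∣ 1 + (n ∸ suc i) - (n ∸ suc i) ∣   ≡⟨ ∣m+n-n∣≡m′ 1 (n ∸ suc i) ⟩
        1                                   ∎
        where
        open ≡-Reasoning
        ∣m+n-n∣≡m′ : ∀ m n → ∣ m + n - n ∣ ≡ m
        ∣m+n-n∣≡m′ m n = trans (∣-∣-comm (m + n) n) (trans (cong (∣ n -_∣) (+-comm m n)) (∣m-m+n∣≡n n m))

  spine-start : ∀ p → start (decode (spine p)) ≡ pair p (fst p)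
  spine-start p = spineUpto-entry p (fst p) 0 z≤n

  spine-end : ∀ p → end (decode (spine p)) ≡ pair p 0
  spine-end p = begin
    ent (spine p) (size (spine p) ∸ 1) ≡⟨ cong (λ m → ent (spine p) (m ∸ 1)) (spineUpto-length p n) ⟩
    ent (spine p) n                    ≡⟨ spineUpto-entry p n n ≤-refl ⟩
    pair p (n ∸ n)                     ≡⟨ cong (pair p) (n∸n≡0 n) ⟩
    pair p 0                           ∎
    where
    open ≡-Reasoning
    n = fst p

  -- The ends of the spine have coordinates `n` and `0`, so a path of at most `r` edges between them
  -- cannot keep to the spine. The scan reports the hub `k` as `suc k`, hence `pred`.
  spine-shortened : ∀ {r p δ} → r < fst p → Short r (spine p) δ → x (pair p (pred (lastHub δ))) ≡ 0
  spine-shortened {r} {p} {δ} r<n short with short (spine-path p)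
  ... | Q , ends , δ≤r with avoids-or-meets δ (size δ)
  ...   | inj₂ (i , i< , k , found , eq) =
    subst (λ h → x (pair p (pred h)) ≡ 0) (sym found)
      (subst (λ p → x (pair p k) ≡ 0) (start-fst ends) (meets⇒x≡0 {δ} Q (i , i< , eq)))
    where
    start-fst : SameEnds (decode (spine p)) (decode δ) → fst (start (decode δ)) ≡ p
    start-fst (inj₁ (eq , _)) = trans (cong fst (trans (sym eq) (spine-start p))) (fst-pair p _)
    start-fst (inj₂ (_ , eq)) = trans (cong fst (trans (sym eq) (spine-end p))) (fst-pair p _)
  ...   | inj₁ (_ , avoids) =
    contradiction (≤-trans (spine-distance Q avoids (size δ ∸ 1) (last< Q)) δ≤r)
                  (<⇒≱ (<-≤-trans r<n (≤-reflexive (sym (far ends)))))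
    where
    -- `SameEnds` allows `δ` to run backwards, but the distance of its ends is `n` either way.
    far : SameEnds (decode (spine p)) (decode δ) →
          ∣ snd (start (decode δ)) - snd (end (decode δ)) ∣ ≡ fst p
    far (inj₁ (s , e)) = trans
      (cong₂ (λ u v → ∣ snd u - snd v ∣) (trans (sym s) (spine-start p)) (trans (sym e) (spine-end p)))
      (trans (cong₂ ∣_-_∣ (snd-pair p (fst p)) (snd-pair p 0)) (∣-∣-identityʳ (fst p)))
    far (inj₂ (s , e)) = trans
      (cong₂ (λ u v → ∣ snd u - snd v ∣) (trans (sym e) (spine-end p)) (trans (sym s) (spine-start p)))
      (cong₂ ∣_-_∣ (snd-pair p 0) (snd-pair p (fst p)))

-- Reducing the complete formula to finite diameter.

graph : Tuple 0 1 → Tuple 0 2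
graph ([] , x ∷ []) = [] , Graph.χV x ∷ Graph.χE x ∷ []

graph-instance : ∀ {x} → All Computable (x ∷ []) → Instance FinDiam-conn (graph ([] , x ∷ []))
graph-instance {x} cs =
  (computable-image (verticesᵉ (arg 0F)) cs ∷ computable-image (edgesᵉ (arg 0F)) cs ∷ []) ,
  Graph.isGraph x

graph-code : ∀ x → run graphᵉ x ≗ code (graph ([] , x ∷ []))
graph-code x = ⊕-ifz (Graph.χV x) (Graph.χE x)

component : ℕ → ℕ
component γ = fst (start (decode γ))

componentᵉ : Exp 1 1 → Exp 1 1
componentᵉ γ = app₁ fstᶜ (app₂ entᶜ γ (lit 0))

-- The value `k` that a realiser of `complete` holds for `p = pair n m`: the successor skips the
-- threshold, and each section adds one pairing.
witnessAt : Baire → ℕ → ℕ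
witnessAt α p = α (suc (pair (fst p) (pair (snd p) 0)))

-- With threshold `t`, a component with `n` below `t` may lack a hub, but then its paths have at
-- most `n` edges; a component with a hub has shortcuts of length 2. Hence the bound `2 + t`.
radiusᵉ : Exp 1 1
radiusᵉ = ifzᵉ (arg 0F) radius (detourᵉ radius γ witness)
  where
  radius  = app₂ addᶜ (lit 2) (ask 0F (lit 0))
  γ       = app₁ fstᶜ (app₁ predᶜ (arg 0F))
  p       = componentᵉ γ
  witness = ask 0F (app₁ sucᶜ (app₂ pairᶜ (app₁ fstᶜ p) (app₂ pairᶜ (app₁ sndᶜ p) (lit 0))))

-- From `n = r + 1` on, a spine has more than `r` edges, so the path of at most `r` edges given for
-- it meets a hub, which is the required `k`.
thresholdᵉ : Exp 1 1
thresholdᵉ = ifzᵉ (arg 0F) (app₁ sucᶜ (ask 0F (lit 0)))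
  (app₁ predᶜ (app₁ lastHubᶜ (ask 0F (app₁ sucᶜ (app₂ pairᶜ (app₁ spineᶜ p) (lit 0))))))
  where
  i = app₁ predᶜ (arg 0F)
  p = app₂ pairᶜ (app₁ fstᶜ i) (app₁ fstᶜ (app₁ sndᶜ i))

-- Asking for `n` at least `r + 1` yields a component without hubs whose spine has more than `r`
-- edges, so its ends are not joined within `r`.
longSpineᵉ : Exp 1 1
longSpineᵉ = app₁ spineᶜ (app₂ pairᶜ (ask 0F (app₂ pairᶜ r+1 (lit 0))) (ask 0F (app₂ pairᶜ r+1 (lit 1))))
  where r+1 = app₁ sucᶜ (app₁ fstᶜ (arg 0F))

longComponentᵉ : Exp 1 1
longComponentᵉ = ifzᵉ (app₁ sndᶜ (arg 0F)) (app₁ fstᶜ p) (app₁ sndᶜ p)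
  where p = componentᵉ (ask 0F (app₂ pairᶜ (app₂ addᶜ (lit 2) (app₁ fstᶜ (arg 0F))) (lit 0)))

module _ (x : Baire) (α : Baire) where

  open Graph x

  realises-radius : Realises complete α ([] , x ∷ []) →
                    Realises FinDiamFormula (run radiusᵉ α) (graph ([] , x ∷ []))
  realises-radius r γ = from (short-code (2 + α 0) γ (run radiusᵉ α (suc (pair γ 0))))
    (subst (λ γ′ → Short (2 + α 0) γ (detour (2 + α 0) γ′ (witnessAt α (component γ′))))
      (sym (fst-pair γ 0))
      (detour-short (α 0) γ (witnessAt α p) λ t≤n →
        subst (λ q → x (pair q (witnessAt α p)) ≡ 0) (pair-unpair p) (r (fst p) t≤n (snd p))))
    where p = component γ

  realises-threshold : Realises FinDiamFormula α (graph ([] , x ∷ [])) →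
                       Realises complete (run thresholdᵉ α) ([] , x ∷ [])
  realises-threshold r n r<n m =
    subst (λ q → x (pair (pair n m) (pred (lastHub (shortPath q)))) ≡ 0) (sym index)
      (spine-shortened {α 0} {pair n m} {shortPath (pair n m)}
        (subst (α 0 <_) (sym (fst-pair n m)) r<n)
        (to (short-code (α 0) (spine (pair n m)) (shortPath (pair n m))) (r (spine (pair n m)))))
    where
    shortPath : ℕ → ℕ
    shortPath p = α (suc (pair (spine p) 0))
    i = pair n (pair m 0)
    index : pair (fst i) (fst (snd i)) ≡ pair n m
    index = cong₂ pair (fst-pair n (pair m 0)) (trans (cong fst (snd-pair n (pair m 0))) (fst-pair m 0))

  realises-longSpine : Realises (dual complete) α ([] , x ∷ []) →
                       Realises (dual FinDiamFormula) (run longSpineᵉ α) (graph ([] , x ∷ []))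
  realises-longSpine h r δ θ =
    proj₂ (h (suc r)) (pred (lastHub δ))
      (spine-shortened {r} {p r} {δ}
        (subst (r <_) (sym (fst-pair (α (pair (suc r) 0)) _)) (proj₁ (h (suc r))))
        (subst (λ s → Short r (spine (p s)) δ) (fst-pair r 0)
          (to (short-code r (spine (p (fst (pair r 0)))) δ) θ)))
    where
    p : ℕ → ℕ
    p r = pair (α (pair (suc r) 0)) (α (pair (suc r) 1))

  -- A path with no detour within `2 + t` refutes, for every `k`, the implication that
  -- `detour-short` assumes. Its antecedent `t ≤ n` therefore holds and its conclusion fails, so no
  -- `k` is a hub.
  realises-longComponent : Realises (dual FinDiamFormula) α (graph ([] , x ∷ [])) →
                           Realises (dual complete) (run longComponentᵉ α) ([] , x ∷ [])
  realises-longComponent h t =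
    subst (t ≤_) (sym index₁) long ,
    λ k → subst (λ q → x (pair q k) ≢ 0) (sym (trans (cong₂ pair index₁ index₂) (pair-unpair p)))
                (λ x≡0 → no-detour k (λ _ → x≡0))
    where
    γ = α (pair (2 + t) 0)
    p = component γ
    no-detour : ∀ k → ¬ (t ≤ fst p → x (pair p k) ≡ 0)
    no-detour k hyp =
      h (2 + t) (detour (2 + t) γ k)
        (from (short-code (2 + t) γ (detour (2 + t) γ k)) (detour-short t γ k hyp))
    long : t ≤ fst p
    -- If `t ≤ n` failed, the implication would hold vacuously, here for `k = 0`. Decidability of
    -- `≤` removes the double negation.
    long = decidable-stable (t ≤? fst p) (λ t≰n → no-detour 0 (λ t≤n → contradiction t≤n t≰n))
    entryOf : ℕ → ℕ → ℕ
    entryOf i s = let q = component (α (pair (2 + s) 0)) in ifz i (fst q) (snd q)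
    index₁ : run longComponentᵉ α (pair t 0) ≡ fst p
    index₁ = cong₂ entryOf (snd-pair t 0) (fst-pair t 0)
    index₂ : run longComponentᵉ α (pair t 1) ≡ snd p
    index₂ = cong₂ entryOf (snd-pair t 1) (fst-pair t 1)

complete≤FinDiam : ⌈ complete ⌉ ≤dm FinDiam-conn
complete≤FinDiam =
  compile₁ 0F graphᵉ ,
  reduction {⌈ complete ⌉} {FinDiam-conn} graphᵉ radiusᵉ thresholdᵉ
    (λ { ([] , x ∷ []) (cs , _) →
      graph ([] , x ∷ []) , graph-instance cs , graph-code x ,
      realises-radius x , realises-threshold x }) ,
  reduction {⌈ complete ⌉ ᵈ} {FinDiam-conn ᵈ} graphᵉ longSpineᵉ longComponentᵉ
    (λ { ([] , x ∷ []) (cs , _) →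
      graph ([] , x ∷ []) , graph-instance cs , graph-code x ,
      realises-longSpine x , realises-longComponent x })

theorem3p23 : Dicomplete (`∀∞ ∷ `∀ ∷ `∃ ∷ []) FinDiam-conn
theorem3p23 = 1 , 0 , complete , complete-strictlyDicomplete , FinDiam≤complete , complete≤FinDiam
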